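{- For every drag $D$ there exists a drag expression all of whose drag components are atomic drags and whose evaluation yields $D$.
   Context: Fix a set $\mathcal{F}$ of function symbols, each with a fixed arity, and a set $\mathcal{X}$ of variables disjoint from $\mathcal{F}$. A drag is a tuple $D=\langle V,R,L,X,S\rangle$ where: $V$ is a finite set of vertices; $R:V\to\mathbb{N}$ is a finite multiset of vertices, the roots ($v$ is rooted if $R(v)>0$); $S\subseteq V$ is the set of sprouts and $I=V\setminus S$ the set of internal vertices; $L:V\to\mathcal{F}\cup\mathcal{X}$ labels internal vertices by function symbols and sprouts by variables; $X:V\to V^*$ assigns to each vertex a list of successors whose length is the arity of its label (sprouts have no successors). If $b$ is the $k$-th element of $X(a)$, then $(a,k,b)$ is an edge with tail $a$ and head $b$. $\mathrm{pred}(v,D)$ is the number of edges with head $v$. Two drags are disjoint if they share neither vertex nor variable; the sum $D\oplus D'$ of disjoint drags is their juxtaposition (union of vertices, roots, labels, edges and sprouts). An equimorphism is a bijection of vertices preserving labels, numbers of roots, and edges (with indices) in both directions. The subdrag of $D$ generated by a vertex $v$ consists of the vertices accessible from $v$ with their labels and edges, each such vertex $w$ getting as roots its roots in $D$ plus the number of edges into $w$ from vertices not accessible from $v$. A wire of a drag $D$ is a pair $s\rightsquigarrow r$ of vertices of $D$ with $s$ a sprout and $r\neq s$. For a set $W$ of wires, $s>_W r$ holds if $s\rightsquigarrow r\in W$, or $s\rightsquigarrow t\in W$ and $t>_W r$ for some $t$. $W$ is well-behaved if it is finite and (1) functional; (2) injective: for every vertex $r$, $\sum_{s>_W r}\mathrm{pred}(s,D)\le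 R(r)$; (3) the restriction of $>_W$ to pairs of sprouts is acyclic. The elementary wiring $D[s\rightsquigarrow r]$ removes the sprout $s$ (with its roots), replaces every edge $(v,i,s)$ by $(v,i,r)$, and sets the number of roots of $r$ to $R(r)-\mathrm{pred}(s,D)$. For well-behaved $W$, $D_\varnothing=D$ and $D_{\{s\rightsquigarrow r\}\cup W'}=(D[s\rightsquigarrow r])_{W'}$ with $s$ maximal for $>_W$ (choice-independent). The resolution of $t\in\mathrm{Dom}(W)$ is the $>_W$-minimal $r$ with $t>_W r$. $W$ is coherent if (1) when some sprout labeled $x$ is an origin of a wire, all sprouts labeled $x$ are; (2) for wires $s\rightsquigarrow r$, $s'\rightsquigarrow r'$ with same-labeled origins, the images of $r,r'$ under the map $D\to D_W$ (identity outside $\mathrm{Dom}(W)$, resolution on $\mathrm{Dom}(W)$) generate equimorphic subdrags of $D_W$. Given disjoint drags $D,D'$, a switchboard for $D,D'$ is a pair of partial functions $\xi_D$ from sprouts of $D$ to rooted vertices of $D'$ and $\xi_{D'}$ from sprouts of $D'$ to rooted vertices of $D$, such that $\xi=\xi_D\cup\xi_{D'}$ is a coherent well-behaved set of wires of $D\oplus D'$. Their product is $D\otimes_\xi D'=(D\oplus D')_\xi$. A drag expression is an expression built, by means of sums $\oplus$ and products $\otimes_\xi$ (with $\xi$ a switchboard for the values of the two arguments), from a set of drags $\{D_i\}_i$, its drag components, such that $D_i$ and $D_j$ share no vertex and no variable for $i\neq j$. An atomic drag is either (a) an atomic vertex: a drag with exactly one internal vertex, carrying any number of roots, whose successors are sprouts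 that are pairwise distinct and carry pairwise distinct labels; or (b) an atomic set of sprouts: a drag with no internal vertex consisting of a nonempty set of pairwise distinct sprouts all labeled by the same variable, each with any number of roots.
   Formalization: The set of variables is assumed infinite (with no variables, a looped unary vertex has no such expression), and the empty sum counts as an expression (needed for the empty drag); equality of variables and of vertices is assumed decidable, which excluded middle supplies. -}

module Defs where

open import Data.Bool.Base using (if_then_else_)
open import Data.List.Base
  using (List; []; _∷_; _++_; map; concatMap; filter; break; length)
open import Data.List.Membership.Propositional using (_∈_; _∉_)
import Data.List.Membership.DecPropositional as DecMembership
open import Data.List.Relation.Binary.Disjoint.Propositional
  renaming (Disjoint to Disjointᴸ)
open import Data.List.Relation.Unary.All using (All; all?)
open import Data.List.Relation.Unary.AllPairs using (AllPairs)
open import Data.List.Relation.Unary.Any using (Any; here; there; any?)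
open import Data.List.Relation.Unary.Unique.Propositional using (Unique)
open import Data.Nat.Base using (ℕ; zero; suc; _+_; _∸_; _≤_; _<_)
open import Data.Nat.ListAction using (sum)
open import Data.Product.Base using (∃; ∃₂; _×_; _,_; proj₁; proj₂)
open import Data.Sum.Base using (_⊎_; inj₁; inj₂)
open import Function.Bundles using (_⇔_)
open import Relation.Binary.Core using (Rel)
open import Relation.Binary.Construct.Closure.ReflexiveTransitive
  using (Star; ε; _◅_; _◅◅_)
  renaming (map to mapStar)
open import Relation.Binary.Construct.Closure.Transitive
  using (TransClosure; [_]; _∷_)
open import Relation.Binary.Definitions using (Decidable; DecidableEquality)
open import Relation.Binary.PropositionalEquality using (_≡_; _≢_; refl)
open import Relation.Nullary.Decidable
  using (Dec; does; yes; no; map′; ¬?; _×-dec_; _⊎-dec_)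
open import Relation.Nullary.Negation using (¬_)

-- Constructive form of "A is infinite".
Infinite : Set → Set
Infinite A = (xs : List A) → ∃ λ x → x ∉ xs

-- 𝓥 is the ambient set from which vertices are drawn.
record Setting : Set₁ where
  field
    𝓕      : Set
    arity  : 𝓕 → ℕ
    𝓧      : Set
    _≟ˣ_   : DecidableEquality 𝓧
    𝓧-inf  : Infinite 𝓧
    𝓥      : Set
    _≟_    : DecidableEquality 𝓥
    𝓥-inf  : Infinite 𝓥

module FiniteRelation {A : Set} (_≟_ : DecidableEquality A) where

  ⟦_⟧ : List (A × A) → Rel A _
  ⟦ E ⟧ a b = (a , b) ∈ E

  private
    split : ∀ {E p q a b} → Star ⟦ (p , q) ∷ E ⟧ a b →
            Star ⟦ E ⟧ a b ⊎ (Star ⟦ E ⟧ a p × Star ⟦ E ⟧ q b)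
    split ε = inj₁ ε
    split (here refl ◅ π) with split π
    ... | inj₁ σ       = inj₂ (ε , σ)
    ... | inj₂ (_ , σ) = inj₂ (ε , σ)
    split (there m ◅ π) with split π
    ... | inj₁ σ       = inj₁ (m ◅ σ)
    ... | inj₂ (ρ , σ) = inj₂ (m ◅ ρ , σ)

    join : ∀ {E p q a b} → Star ⟦ E ⟧ a b ⊎ (Star ⟦ E ⟧ a p × Star ⟦ E ⟧ q b) →
           Star ⟦ (p , q) ∷ E ⟧ a b
    join (inj₁ σ)       = mapStar there σ
    join (inj₂ (ρ , σ)) = mapStar there ρ ◅◅ (here refl ◅ mapStar there σ)

    ε-only : ∀ {a b} → Star ⟦ [] ⟧ a b → a ≡ b
    ε-only ε = refl
    ε-only (() ◅ _)

  star? : ∀ E → Decidable (Star ⟦ E ⟧)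
  star? []            a b = map′ (λ { refl → ε }) ε-only (a ≟ b)
  star? ((p , q) ∷ E) a b =
    map′ join split (star? E a b ⊎-dec (star? E a p ×-dec star? E q b))

  private
    snoc⁺ : ∀ {E a b c} → ⟦ E ⟧ a b → Star ⟦ E ⟧ b c → TransClosure ⟦ E ⟧ a c
    snoc⁺ m ε       = [ m ]
    snoc⁺ m (n ◅ π) = m ∷ snoc⁺ n π

    star : ∀ {E a b} → TransClosure ⟦ E ⟧ a b → Star ⟦ E ⟧ a b
    star [ m ]   = m ◅ ε
    star (m ∷ π) = m ◅ star π

    first : ∀ {E a b} → TransClosure ⟦ E ⟧ a b →
            ∃ λ c → ⟦ E ⟧ a c × Star ⟦ E ⟧ c b
    first [ m ]   = _ , m , ε
    first (m ∷ π) = _ , m , star π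

    pick : ∀ {E F a b} → Any (λ e → proj₁ e ≡ a × Star ⟦ F ⟧ (proj₂ e) b) E →
           ∃ λ c → ⟦ E ⟧ a c × Star ⟦ F ⟧ c b
    pick (here (refl , π)) = _ , here refl , π
    pick (there p) with pick p
    ... | c , m , π = c , there m , π

    unpick : ∀ {E F a b c} → ⟦ E ⟧ a c → Star ⟦ F ⟧ c b →
             Any (λ e → proj₁ e ≡ a × Star ⟦ F ⟧ (proj₂ e) b) E
    unpick (here refl) π = here (refl , π)
    unpick (there m)   π = there (unpick m π)

  trans⁺? : ∀ E → Decidable (TransClosure ⟦ E ⟧)
  trans⁺? E a b =
    map′ (λ p → let _ , m , π = pick p in snoc⁺ m π)
         (λ t → let _ , m , π = first t in unpick m π)
         (any? (λ e → (proj₁ e ≟ a) ×-dec star? E (proj₂ e) b) E)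

module Drags (𝓢 : Setting) where

  open Setting 𝓢 public
  open FiniteRelation _≟_ public
  open DecMembership _≟_ public using (_∈?_)

  Label : Set
  Label = 𝓕 ⊎ 𝓧

  labelArity : Label → ℕ
  labelArity (inj₁ f) = arity f
  labelArity (inj₂ x) = 0

  -- R, L and X are total functions on 𝓥, but their values outside V carry no
  -- information: every notion below only depends on their restriction to V.
  -- The set S of sprouts is determined by L.
  record RawDrag : Set where
    field
      V : List 𝓥
      R : 𝓥 → ℕ
      L : 𝓥 → Label
      X : 𝓥 → List 𝓥

  open RawDrag public

  record IsDrag (D : RawDrag) : Set where
    field
      V-unique : Unique (V D)
      X-arity  : ∀ {v} → v ∈ V D → length (X D v) ≡ labelArity (L D v)
      X-closed : ∀ {v w} → v ∈ V D → w ∈ X D v → w ∈ V D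

  record Drag : Set where
    field
      raw    : RawDrag
      isDrag : IsDrag raw

  open Drag public

  infix 4 _≈_

  record _≈_ (D E : RawDrag) : Set where
    field
      V-≈ : ∀ {v} → v ∈ V D ⇔ v ∈ V E
      R-≈ : ∀ {v} → v ∈ V D → R D v ≡ R E v
      L-≈ : ∀ {v} → v ∈ V D → L D v ≡ L E v
      X-≈ : ∀ {v} → v ∈ V D → X D v ≡ X E v

  SproutLabelled : RawDrag → 𝓥 → 𝓧 → Set
  SproutLabelled D v x = v ∈ V D × L D v ≡ inj₂ x

  Sprout : RawDrag → 𝓥 → Set
  Sprout D v = ∃ λ x → SproutLabelled D v x

  Internal : RawDrag → 𝓥 → Set
  Internal D v = v ∈ V D × ∃ λ f → L D v ≡ inj₁ f

  Rooted : RawDrag → 𝓥 → Set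
  Rooted D v = v ∈ V D × 0 < R D v

  -- The edges (a , k , b), listed with multiplicity, as pairs (a , b); the
  -- index k is the position of the entry within X a.
  edges : RawDrag → List (𝓥 × 𝓥)
  edges D = concatMap (λ a → map (a ,_) (X D a)) (V D)

  pred : 𝓥 → RawDrag → ℕ
  pred v D = length (filter (λ e → proj₂ e ≟ v) (edges D))

  record Disjoint (D E : RawDrag) : Set where
    field
      V-disjoint : Disjointᴸ (V D) (V E)
      𝓧-disjoint : ∀ {s t x} → SproutLabelled D s x → ¬ SproutLabelled E t x

  infixr 6 _⊕_

  -- Only meaningful for disjoint arguments.
  _⊕_ : RawDrag → RawDrag → RawDrag
  D ⊕ E = record
    { V = V D ++ V E
    ; R = choose (R D) (R E)
    ; L = choose (L D) (L E)
    ; X = choose (X D) (X E)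
    }
    where
    choose : {A : Set} → (𝓥 → A) → (𝓥 → A) → 𝓥 → A
    choose f g v = if does (v ∈? V D) then f v else g v

  ∅ : RawDrag
  ∅ = record
    { V = []
    ; R = λ _ → 0
    ; L = λ _ → inj₂ (proj₁ (𝓧-inf []))
    ; X = λ _ → []
    }

  -- Since X lists successors in order, the field X-pres says that (a , k , b)
  -- is an edge of D iff (to a , k , to b) is an edge of E.
  record Equimorphic (D E : RawDrag) : Set where
    field
      to      : 𝓥 → 𝓥
      from    : 𝓥 → 𝓥
      to-∈    : ∀ {v} → v ∈ V D → to v ∈ V E
      from-∈  : ∀ {v} → v ∈ V E → from v ∈ V D
      from-to : ∀ {v} → v ∈ V D → from (to v) ≡ v
      to-from : ∀ {v} → v ∈ V E → to (from v) ≡ v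
      L-pres  : ∀ {v} → v ∈ V D → L E (to v) ≡ L D v
      R-pres  : ∀ {v} → v ∈ V D → R E (to v) ≡ R D v
      X-pres  : ∀ {v} → v ∈ V D → X E (to v) ≡ map to (X D v)

  Accessible : RawDrag → Rel 𝓥 _
  Accessible D = Star ⟦ edges D ⟧

  accessible? : ∀ D → Decidable (Accessible D)
  accessible? D = star? (edges D)

  subdrag : RawDrag → 𝓥 → RawDrag
  subdrag D v = record
    { V = filter (accessible? D v) (V D)
    ; R = λ w → R D w + length (filter (entering? w) (edges D))
    ; L = L D
    ; X = X D
    }
    where
    entering? : ∀ w (e : 𝓥 × 𝓥) → Dec (proj₂ e ≡ w × ¬ Accessible D v (proj₁ e))
    entering? w e = (proj₂ e ≟ w) ×-dec ¬? (accessible? D v (proj₁ e))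

  -- (s , r) stands for the wire s ⇝ r.
  Wires : Set
  Wires = List (𝓥 × 𝓥)

  IsWire : RawDrag → 𝓥 × 𝓥 → Set
  IsWire D (s , r) = Sprout D s × r ∈ V D × r ≢ s

  infix 4 _>[_]_

  _>[_]_ : 𝓥 → Wires → 𝓥 → Set
  s >[ W ] r = TransClosure ⟦ W ⟧ s r

  Origin : Wires → 𝓥 → Set
  Origin W s = s ∈ map proj₁ W

  record WellBehaved (D : RawDrag) (W : Wires) : Set where
    field
      wires      : All (IsWire D) W
      functional : ∀ {s r r′} → (s , r) ∈ W → (s , r′) ∈ W → r ≡ r′
      injective  : ∀ {r} → r ∈ V D →
                   sum (map (λ s → pred s D) (filter (λ s → trans⁺? W s r) (V D)))
                     ≤ R D r
      acyclic    : ∀ {s} →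
                   ¬ TransClosure (λ t u → Sprout D t × Sprout D u × t >[ W ] u) s s

  infixl 7 _[_⇝_]

  -- For well-behaved wirings the truncated subtraction never truncates.
  _[_⇝_] : RawDrag → 𝓥 → 𝓥 → RawDrag
  D [ s ⇝ r ] = record
    { V = filter (λ v → ¬? (v ≟ s)) (V D)
    ; R = λ v → if does (v ≟ r) then R D r ∸ pred s D else R D v
    ; L = L D
    ; X = λ v → map (λ w → if does (w ≟ s) then r else w) (X D v)
    }

  -- Only origins of wires can be greater than s.
  Maximal : Wires → 𝓥 → Set
  Maximal W s = All (λ w → ¬ (proj₁ w >[ W ] s)) W

  maximal? : ∀ W s → Dec (Maximal W s)
  maximal? W s = all? (λ w → ¬? (trans⁺? W (proj₁ w) s)) W

  wireFor : ℕ → RawDrag → Wires → RawDrag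
  wireFor zero    D W = D
  wireFor (suc n) D W with break (λ w → maximal? W (proj₁ w)) W
  ... | W₁ , []           = D
  ... | W₁ , (s , r) ∷ W₂ = wireFor n (D [ s ⇝ r ]) (W₁ ++ W₂)

  infixl 7 _⟨_⟩

  -- D ⟨ W ⟩ is D_W. At each step the first wire with a maximal origin is
  -- processed; one exists as long as W is well-behaved and nonempty.
  _⟨_⟩ : RawDrag → Wires → RawDrag
  D ⟨ W ⟩ = wireFor (length W) D W

  Resolution : Wires → 𝓥 → 𝓥 → Set
  Resolution W t r = t >[ W ] r × (∀ u → ¬ (r >[ W ] u))

  -- The graph of the map D → D_W.
  Image : Wires → 𝓥 → 𝓥 → Set
  Image W t u = (¬ Origin W t × u ≡ t) ⊎ (Origin W t × Resolution W t u)

  record Coherent (D : RawDrag) (W : Wires) : Set where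
    field
      saturated  : ∀ {s s′ x} → SproutLabelled D s x → SproutLabelled D s′ x →
                   Origin W s → Origin W s′
      compatible : ∀ {s r s′ r′ x} → (s , r) ∈ W → (s′ , r′) ∈ W →
                   SproutLabelled D s x → SproutLabelled D s′ x →
                   ∃₂ λ u u′ → Image W r u × Image W r′ u′ ×
                     Equimorphic (subdrag (D ⟨ W ⟩) u) (subdrag (D ⟨ W ⟩) u′)

  -- The partial functions ξ_D and ξ_E are given by their graphs, which are
  -- single-valued because ξ is functional.
  record Switchboard (D E : RawDrag) : Set where
    field
      ξₗ          : Wires
      ξᵣ          : Wires
      ξₗ-typed    : All (λ w → Sprout D (proj₁ w) × Rooted E (proj₂ w)) ξₗ
      ξᵣ-typed    : All (λ w → Sprout E (proj₁ w) × Rooted D (proj₂ w)) ξᵣ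

    ξ : Wires
    ξ = ξₗ ++ ξᵣ

    field
      wellBehaved : WellBehaved (D ⊕ E) ξ
      coherent    : Coherent (D ⊕ E) ξ

  product : (D E : RawDrag) → Switchboard D E → RawDrag
  product D E ξ = (D ⊕ E) ⟨ Switchboard.ξ ξ ⟩

  -- emptySum is the expression built from no component. It is what makes the
  -- empty drag expressible, since sums and products of nonempty drags are
  -- nonempty.
  data Expr : Set
  value : Expr → RawDrag

  data Expr where
    component : Drag → Expr
    emptySum  : Expr
    sumExpr   : (e₁ e₂ : Expr) → Disjoint (value e₁) (value e₂) → Expr
    prodExpr  : (e₁ e₂ : Expr) → Disjoint (value e₁) (value e₂) →
                Switchboard (value e₁) (value e₂) → Expr

  value (component D)        = raw D
  value emptySum             = ∅
  value (sumExpr e₁ e₂ _)    = value e₁ ⊕ value e₂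
  value (prodExpr e₁ e₂ _ ξ) = product (value e₁) (value e₂) ξ

  components : Expr → List Drag
  components (component D)        = D ∷ []
  components emptySum             = []
  components (sumExpr e₁ e₂ _)    = components e₁ ++ components e₂
  components (prodExpr e₁ e₂ _ _) = components e₁ ++ components e₂

  record DragExpression : Set where
    field
      expr     : Expr
      disjoint : AllPairs (λ D E → Disjoint (raw D) (raw E)) (components expr)

  open DragExpression public

  -- D consists of the vertex and its successors only.
  record IsAtomicVertex (D : RawDrag) : Set where
    field
      vertex            : 𝓥
      internal          : Internal D vertex
      internal-unique   : ∀ {v} → Internal D v → v ≡ vertex
      sprouts-are-succs : ∀ {v} → Sprout D v → v ∈ X D vertex
      succs-are-sprouts : All (Sprout D) (X D vertex)
      succs-unique      : Unique (X D vertex)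
      labels-unique     : Unique (map (L D) (X D vertex))

  record IsAtomicSproutSet (D : RawDrag) : Set where
    field
      variableName : 𝓧
      nonempty     : ∃ λ v → v ∈ V D
      all-labelled : ∀ {v} → v ∈ V D → L D v ≡ inj₂ variableName

  IsAtomic : Drag → Set
  IsAtomic D = IsAtomicVertex (raw D) ⊎ IsAtomicSproutSet (raw D)

{-# OPTIONS --safe #-}
module Submission where

-- Give every edge e two fresh sprouts s e and t e. Let A be the sum of the
-- atomic vertices of D, in which every edge e is cut so that it ends in s e,
-- and of the sprout sets of D, one for each variable; let B be the sum of the
-- single sprouts t e. The wires s e ⇝ t e and t e ⇝ head e then form a
-- switchboard for A and B whose product is D. The detour through t e is needed
-- because a wire of a switchboard must lead from one factor to the other, and
-- both s e and head e are vertices of A. Fresh variables make coherence trivial.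


open import Defs
open import Data.Bool.Base using (if_then_else_)
open import Data.Empty using (⊥; ⊥-elim)
open import Data.Fin.Base using (toℕ)
open import Data.Fin.Properties using (toℕ-injective)
open import Data.List.Base
  using (List; []; _∷_; [_]; _++_; map; concat; concatMap; filter; break; foldl; length;
         lookup; tabulate; deduplicate)
open import Data.List.Membership.Propositional using (_∈_; _∉_; find; lose)
open import Data.List.Membership.Propositional.Properties
open import Data.List.Membership.Propositional.Properties.WithK using (unique∧set⇒bag)
import Data.List.Membership.DecPropositional as DecMembership
open import Data.List.Properties
  using (++-identityʳ; concat-++; concat-map-[_]; concatMap-++; filter-++; filter-all; filter-none;
         filter-reject; filter-some; foldl-++; length-++; length-map; length-tabulate;
         map-++; map-cong; map-cong-local; map-id; map-tabulate; map-∘; tabulate-lookup)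
open import Data.List.Relation.Binary.BagAndSetEquality using (∼bag⇒↭)
open import Data.List.Relation.Binary.Permutation.Propositional
  using (_↭_; prep; swap; ↭-refl; ↭-reflexive; ↭-trans; ↭-sym)
import Data.List.Relation.Binary.Permutation.Propositional.Properties as ↭
open import Data.List.Relation.Unary.All as All using (All; []; _∷_)
import Data.List.Relation.Unary.All.Properties as All
open import Data.List.Relation.Unary.AllPairs as AllPairs using (AllPairs; []; _∷_)
import Data.List.Relation.Unary.AllPairs.Properties as AllPairs
open import Data.List.Relation.Unary.Any using (here; there)
open import Data.List.Relation.Unary.Unique.Propositional using (Unique)
import Data.List.Relation.Unary.Unique.Propositional.Properties as Unique
import Data.List.Relation.Unary.Unique.DecPropositional.Properties as DecUnique
open import Data.Nat.Base using (ℕ; suc; _+_; _∸_; _≤_; _<_; z≤n; s≤s)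
open import Data.Nat.ListAction using (sum)
import Data.Nat.Properties as ℕ
open import Data.Product.Base using (∃; ∃₂; _×_; _,_; proj₁; proj₂)
open import Data.Product.Properties using (≡-dec)
open import Data.Sum.Base using (_⊎_; inj₁; inj₂; [_,_]′)
open import Function.Base using (_∘_; id)
open import Function.Bundles using (mk⇔)
open import Relation.Binary.Construct.Closure.Transitive using (TransClosure; _∷_)
  renaming ([_] to [_]⁺; _++_ to _++⁺_)
open import Relation.Binary.Definitions using (DecidableEquality)
open import Relation.Binary.PropositionalEquality
  using (_≡_; _≢_; refl; sym; trans; cong; cong₂; subst; module ≡-Reasoning)
open import Relation.Nullary.Decidable using (Dec; does; yes; no; ¬?; dec-true; dec-false)
open import Relation.Nullary.Negation using (¬_; contradiction)
open import Relation.Unary using (Decidable)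

-- Lists

-- Components share no variable, so all sprouts of `D` with the same variable must lie in one
-- component, while the sprouts of an atomic vertex carry distinct variables. Hence edges into
-- sprouts of `D` are cut like all others, and every cut end gets a variable of its own. As all
-- edges are cut at once, cycles need no special treatment: a single product restores every edge.
--
-- The order of the wires consists of chains `s e > t e > head e` only, so all wires from the `s e`
-- can be processed before those from the `t e`. In the sum of the two factors each `s e` has
-- in-degree one and every other vertex in-degree zero. Injectivity therefore asks for one root at
-- `t e` and, at a vertex of `D`, for as many roots as it has incoming edges in `D`. These are
-- granted on top of its roots in `D`, and the wiring takes away exactly as many.

module _ {A : Set} where

  count : {P : A → Set} → Decidable P → List A → ℕ
  count P? xs = length (filter P? xs)

  count-∪ : {P Q R : A → Set} (P? : Decidable P) (Q? : Decidable Q) (R? : Decidable R) →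
            ∀ xs → (∀ {x} → P x → Q x → ⊥) →
            (∀ {x} → x ∈ xs → P x → R x) → (∀ {x} → x ∈ xs → Q x → R x) →
            count P? xs + count Q? xs ≤ count R? xs
  count-∪ P? Q? R? []       P∩Q P⊆R Q⊆R = z≤n
  count-∪ P? Q? R? (x ∷ xs) P∩Q P⊆R Q⊆R
    with ih ← count-∪ P? Q? R? xs P∩Q (P⊆R ∘ there) (Q⊆R ∘ there) | P? x | Q? x | R? x
  ... | yes p | yes q | _     = ⊥-elim (P∩Q p q)
  ... | yes p | no  _ | yes _ = s≤s ih
  ... | yes p | no  _ | no ¬r = contradiction (P⊆R (here refl) p) ¬r
  ... | no  _ | yes q | yes _ =
    ℕ.≤-trans (ℕ.≤-reflexive (ℕ.+-suc (count P? xs) (count Q? xs))) (s≤s ih)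
  ... | no  _ | yes q | no ¬r = contradiction (Q⊆R (here refl) q) ¬r
  ... | no  _ | no  _ | yes _ = ℕ.m≤n⇒m≤1+n ih
  ... | no  _ | no  _ | no  _ = ih

  count-mono : {P Q : A → Set} (P? : Decidable P) (Q? : Decidable Q) → ∀ xs →
               (∀ {x} → x ∈ xs → P x → Q x) → count P? xs ≤ count Q? xs
  -- The second summand of `count-∪` is the count of the empty predicate.
  count-mono P? Q? xs P⊆Q = ℕ.≤-trans (ℕ.m≤m+n _ _)
    (count-∪ P? (λ _ → no id) Q? xs (λ _ ()) P⊆Q (λ _ ()))

  count-unique : {P : A → Set} (P? : Decidable P) → ∀ {xs} → Unique xs →
                 (∀ {x y} → x ∈ xs → y ∈ xs → P x → P y → x ≡ y) → count P? xs ≤ 1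
  count-unique P? []                    P! = z≤n
  count-unique P? {x ∷ xs} (x∉xs ∷ xs!) P! with P? x
  ... | yes p = s≤s (ℕ.≤-reflexive (cong length (filter-none P?
          (All.tabulate λ y∈xs q → All.lookup x∉xs y∈xs (P! (here refl) (there y∈xs) p q)))))
  ... | no  _ = count-unique P? xs! (λ x∈ y∈ → P! (there x∈) (there y∈))

  count-++ : {P : A → Set} (P? : Decidable P) → ∀ xs ys →
             count P? (xs ++ ys) ≡ count P? xs + count P? ys
  count-++ P? xs ys = trans (cong length (filter-++ P? xs ys)) (length-++ (filter P? xs))

  unique⇒allPairs : ∀ {P : A → A → Set} {xs} → Unique xs →
                    (∀ {x y} → x ∈ xs → y ∈ xs → x ≢ y → P x y) → AllPairs P xs
  unique⇒allPairs []           p = []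
  unique⇒allPairs (x∉xs ∷ xs!) p =
    All.tabulate (λ y∈ → p (here refl) (there y∈) (All.lookup x∉xs y∈))
    ∷ unique⇒allPairs xs! λ x∈ y∈ → p (there x∈) (there y∈)

  ∈-resp-≡ : ∀ {x : A} {xs ys} → xs ≡ ys → x ∈ xs → x ∈ ys
  ∈-resp-≡ refl x∈ = x∈

  break-here : {P : A → Set} (P? : Decidable P) → ∀ {x xs} → P x →
               break P? (x ∷ xs) ≡ ([] , x ∷ xs)
  break-here P? {x} p with P? x
  ... | yes _ = refl
  ... | no ¬p = contradiction p ¬p

module _ {A B : Set} where

  InjectiveOn : List A → (A → B) → Set
  InjectiveOn xs f = ∀ {x y} → x ∈ xs → y ∈ xs → f x ≡ f y → x ≡ y

  map-unique : ∀ {f xs} → InjectiveOn xs f → Unique xs → Unique (map f xs)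
  map-unique inj []           = []
  map-unique inj (x∉xs ∷ xs!) =
    All.map⁺ (All.tabulate λ y∈xs eq → All.lookup x∉xs y∈xs (inj (here refl) (there y∈xs) eq))
    ∷ map-unique (λ x∈ y∈ → inj (there x∈) (there y∈)) xs!

  count-map : {P : B → Set} (P? : Decidable P) (f : A → B) → ∀ xs →
              count P? (map f xs) ≡ count (P? ∘ f) xs
  count-map P? f []       = refl
  count-map P? f (x ∷ xs) with P? (f x)
  ... | yes _ = cong suc (count-map P? f xs)
  ... | no  _ = count-map P? f xs

  concatMap-[] : ∀ {f : A → List B} xs → (∀ {x} → x ∈ xs → f x ≡ []) → concatMap f xs ≡ []
  concatMap-[] []       eq = refl
  concatMap-[] (x ∷ xs) eq = cong₂ _++_ (eq (here refl)) (concatMap-[] xs (eq ∘ there))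

  concatMap-↭ : ∀ (f : A → List B) {xs ys} → xs ↭ ys → concatMap f xs ↭ concatMap f ys
  concatMap-↭ f _↭_.refl        = ↭-refl
  concatMap-↭ f (prep x p)      = ↭.++⁺ˡ (f x) (concatMap-↭ f p)
  concatMap-↭ f (swap x y p)    =
    ↭-trans (↭.++⁺ˡ (f x) (↭.++⁺ˡ (f y) (concatMap-↭ f p))) (↭.shifts (f x) (f y))
  concatMap-↭ f (_↭_.trans p q) = ↭-trans (concatMap-↭ f p) (concatMap-↭ f q)

  abstract
    -- Induction on `xs`: the value at `a` avoids `avoid` and all values chosen for the rest. It
    -- overrides the old function at every occurrence of `a`, so repetitions in `xs` do no harm.
    fresh : DecidableEquality A → Infinite B → ∀ avoid xs →
            ∃ λ (f : A → B) → (∀ {x} → x ∈ xs → f x ∉ avoid) × InjectiveOn xs f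
    fresh _≟_ inf avoid []       = (λ _ → proj₁ (inf [])) , (λ ()) , λ ()
    fresh _≟_ inf avoid (a ∷ xs)
      with f , f-fresh , f-inj ← fresh _≟_ inf avoid xs
      with b , b-new ← inf (avoid ++ map f xs) = f′ , f′-fresh , f′-inj
      where
      f′ : A → B
      f′ x = if does (x ≟ a) then b else f x

      f′-fresh : ∀ {x} → x ∈ a ∷ xs → f′ x ∉ avoid
      f′-fresh {x} x∈ with x ≟ a | x∈
      ... | yes _  | _         = b-new ∘ ∈-++⁺ˡ
      ... | no x≢a | here x≡a  = contradiction x≡a x≢a
      ... | no _   | there x∈′ = f-fresh x∈′

      b≢f : ∀ {x} → x ∈ xs → b ≢ f x
      b≢f x∈ refl = b-new (∈-++⁺ʳ avoid (∈-map⁺ f x∈))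

      f′-inj : InjectiveOn (a ∷ xs) f′
      f′-inj {x} {y} x∈ y∈ eq with x ≟ a | y ≟ a | x∈ | y∈
      ... | yes x≡a | yes y≡a | _         | _         = trans x≡a (sym y≡a)
      ... | yes _   | no y≢a  | _         | here y≡a  = contradiction y≡a y≢a
      ... | yes _   | no _    | _         | there y∈′ = contradiction eq (b≢f y∈′)
      ... | no x≢a  | _       | here x≡a  | _         = contradiction x≡a x≢a
      ... | no _    | yes _   | there x∈′ | _         = contradiction (sym eq) (b≢f x∈′)
      ... | no _    | no y≢a  | there _   | here y≡a  = contradiction y≡a y≢a
      ... | no _    | no _    | there x∈′ | there y∈′ = f-inj x∈′ y∈′ eq

module _ {A B C : Set} where

  count-concatMap : {P : B → Set} (P? : Decidable P) {Q : C → Set} (Q? : Decidable Q)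
                    (f : A → List B) (g : A → List C) → ∀ xs →
                    (∀ {x} → x ∈ xs → count P? (f x) ≡ count Q? (g x)) →
                    count P? (concatMap f xs) ≡ count Q? (concatMap g xs)
  count-concatMap P? Q? f g []       eq = refl
  count-concatMap P? Q? f g (x ∷ xs) eq = begin
    count P? (f x ++ concatMap f xs)           ≡⟨ count-++ P? (f x) _ ⟩
    count P? (f x) + count P? (concatMap f xs)
      ≡⟨ cong₂ _+_ (eq (here refl)) (count-concatMap P? Q? f g xs (eq ∘ there)) ⟩
    count Q? (g x) + count Q? (concatMap g xs) ≡⟨ count-++ Q? (g x) _ ⟨
    count Q? (g x ++ concatMap g xs)           ∎
    where open ≡-Reasoning

module _ {A B : Set} (_≟_ : DecidableEquality B) (f : A → B) where

  open DecMembership _≟_ using (_∈?_)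

  -- Fibres of `f` over distinct values are disjoint. This turns the sum of in-degrees in the
  -- injectivity condition into a single count of edges.
  sum-count≤ : ∀ xs {us} → Unique us →
               sum (map (λ u → count (λ x → f x ≟ u) xs) us) ≤ count (λ x → f x ∈? us) xs
  sum-count≤ xs []                    = z≤n
  sum-count≤ xs {u ∷ us} (u∉us ∷ us!) = begin
    count (λ x → f x ≟ u) xs + sum (map _ us)
      ≤⟨ ℕ.+-monoʳ-≤ _ (sum-count≤ xs us!) ⟩
    count (λ x → f x ≟ u) xs + count (λ x → f x ∈? us) xs
      ≤⟨ count-∪ _ _ (λ x → f x ∈? (u ∷ us)) xs
           (λ { refl u∈us → All.lookup u∉us u∈us refl }) (λ _ → here) (λ _ → there) ⟩
    count (λ x → f x ∈? (u ∷ us)) xs ∎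
    where open ℕ.≤-Reasoning

module _ (𝓢 : Setting) where

  open Drags 𝓢

  -- Elementary wirings

  step : RawDrag → 𝓥 × 𝓥 → RawDrag
  step D (s , r) = D [ s ⇝ r ]

  L-foldl-step : ∀ W D → L (foldl step D W) ≡ L D
  L-foldl-step []      D = refl
  L-foldl-step (w ∷ W) D = L-foldl-step W (step D w)

  -- Guarantees that at every step of D ⟨ W ⟩ the first wire has a maximal origin.
  data Ordered : Wires → Set where
    []  : Ordered []
    _∷_ : ∀ {w W} → proj₁ w ∉ map proj₂ (w ∷ W) → Ordered W → Ordered (w ∷ W)

  target-∈ : ∀ {W a b} → a >[ W ] b → b ∈ map proj₂ W
  target-∈ [ m ]⁺  = ∈-map⁺ proj₂ m
  target-∈ (_ ∷ p) = target-∈ p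

  -- Every chain of wires ends in the target of a wire. The first origin is no target, hence
  -- maximal, and the search for a maximal origin stops at once; evaluation becomes a plain left
  -- fold.
  ⟨⟩-ordered : ∀ D {W} → Ordered W → D ⟨ W ⟩ ≡ foldl step D W
  ⟨⟩-ordered D []            = refl
  ⟨⟩-ordered D (_∷_ {w} {W} w∉ o)
    rewrite break-here (λ w′ → maximal? (w ∷ W) (proj₁ w′)) {w} {W}
              (All.tabulate λ _ → w∉ ∘ target-∈)
    = ⟨⟩-ordered (step D w) o

  ordered-map-++ : ∀ {A : Set} (a b : A → 𝓥) es {W} →
    (∀ {e e′} → e ∈ es → e′ ∈ es → a e ≢ b e′) →
    (∀ {e} → e ∈ es → a e ∉ map proj₂ W) →
    Ordered W → Ordered (map (λ e → a e , b e) es ++ W)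
  ordered-map-++ a b []       a≢b a∉W o = o
  ordered-map-++ a b (e ∷ es) {W} a≢b a∉W o =
    notTarget ∷ ordered-map-++ a b es (λ x y → a≢b (there x) (there y)) (a∉W ∘ there) o
    where
    notTarget : a e ∉ map proj₂ (map (λ e → a e , b e) (e ∷ es) ++ W)
    notTarget p with ∈-map⁻ proj₂ p
    ... | w , w∈ , eq with ∈-++⁻ (map (λ e → a e , b e) (e ∷ es)) w∈
    ... | inj₂ w∈W = a∉W (here refl) (subst (_∈ map proj₂ W) (sym eq) (∈-map⁺ proj₂ w∈W))
    ... | inj₁ w∈es with ∈-map⁻ (λ e → a e , b e) w∈es
    ... | e′ , e′∈ , refl = a≢b (here refl) e′∈ eq

  -- Sums of parts of a fixed family of functions R, L, X

  infix 4 _≐_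

  -- Finer than `_≈_`, since the vertex lists agree in order and multiplicity. The functions are
  -- compared on vertices only: `⊕` picks values by a membership test, so elsewhere a sum need not
  -- agree with a fixed `M`.
  record _≐_ (D E : RawDrag) : Set where
    field
      V-≡ : V D ≡ V E
      R-≡ : ∀ {v} → v ∈ V E → R D v ≡ R E v
      L-≡ : ∀ {v} → v ∈ V E → L D v ≡ L E v
      X-≡ : ∀ {v} → v ∈ V E → X D v ≡ X E v

  open _≐_ public

  Equimorphic-refl : ∀ {D} → Equimorphic D D
  Equimorphic-refl {D} = record
    { to      = id
    ; from    = id
    ; to-∈    = id
    ; from-∈  = id
    ; from-to = λ _ → refl
    ; to-from = λ _ → refl
    ; L-pres  = λ _ → refl
    ; R-pres  = λ _ → refl
    ; X-pres  = λ {v} _ → sym (map-id (X D v))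
    }

  Disjoint-resp-≐ : ∀ {D D′ E E′} → D ≐ D′ → E ≐ E′ → Disjoint D′ E′ → Disjoint D E
  Disjoint-resp-≐ D≐ E≐ dis = record
    { V-disjoint = λ { (v∈D , v∈E) → Disjoint.V-disjoint dis
        (∈-resp-≡ (V-≡ D≐) v∈D , ∈-resp-≡ (V-≡ E≐) v∈E) }
    ; 𝓧-disjoint = λ s∶x t∶x →
        Disjoint.𝓧-disjoint dis (transport D≐ s∶x) (transport E≐ t∶x)
    }
    where
    transport : ∀ {D D′ v x} → D ≐ D′ → SproutLabelled D v x → SproutLabelled D′ v x
    transport D≐ (v∈ , Lv) =
      let v∈′ = ∈-resp-≡ (V-≡ D≐) v∈ in v∈′ , trans (sym (L-≡ D≐ v∈′)) Lv

  module Parts (M : RawDrag) where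

    part : List 𝓥 → RawDrag
    part vs = record { V = vs ; R = R M ; L = L M ; X = X M }

    -- Both branches of the membership test in `⊕` return the value prescribed by `M`. This is the
    -- reason for drawing all components from one family of functions.
    ⊕-part : ∀ {D E vs ws} → D ≐ part vs → E ≐ part ws → D ⊕ E ≐ part (vs ++ ws)
    ⊕-part {D} {E} {vs} {ws} D≐ E≐ = record
      { V-≡ = cong₂ _++_ (V-≡ D≐) (V-≡ E≐)
      ; R-≡ = choose (R-≡ D≐) (R-≡ E≐)
      ; L-≡ = choose (L-≡ D≐) (L-≡ E≐)
      ; X-≡ = choose (X-≡ D≐) (X-≡ E≐)
      }
      where
      choose : ∀ {A : Set} {f g h : 𝓥 → A} →
               (∀ {v} → v ∈ vs → f v ≡ h v) → (∀ {v} → v ∈ ws → g v ≡ h v) →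
               ∀ {v} → v ∈ vs ++ ws → (if does (v ∈? V D) then f v else g v) ≡ h v
      choose f≡h g≡h {v} v∈ with v ∈? V D | ∈-++⁻ vs v∈
      ... | yes v∈D | _         = f≡h (∈-resp-≡ (V-≡ D≐) v∈D)
      ... | no  v∉D | inj₁ v∈vs = contradiction (∈-resp-≡ (sym (V-≡ D≐)) v∈vs) v∉D
      ... | no  _   | inj₂ v∈ws = g≡h v∈ws

    -- `Disjoint` for a single pair of vertices; in this form it passes to concatenations pair by
    -- pair.
    Apart : 𝓥 → 𝓥 → Set
    Apart u w = u ≢ w × (∀ {x} → L M u ≡ inj₂ x → L M w ≢ inj₂ x)

    Separate : List 𝓥 → List 𝓥 → Set
    Separate vs ws = ∀ {u w} → u ∈ vs → w ∈ ws → Apart u w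

    separate⇒disjoint : ∀ {vs ws} → Separate vs ws → Disjoint (part vs) (part ws)
    separate⇒disjoint sep = record
      { V-disjoint = λ { (v∈vs , v∈ws) → proj₁ (sep v∈vs v∈ws) refl }
      ; 𝓧-disjoint = λ { (s∈ , Ls) (t∈ , Lt) → proj₂ (sep s∈ t∈) Ls Lt }
      }

    separate-concatʳ : ∀ {vs wss} → All (Separate vs) wss → Separate vs (concat wss)
    separate-concatʳ {wss = wss} sep u∈ w∈ with ∈-concat⁻′ wss w∈
    ... | ws , w∈ws , ws∈ = All.lookup sep ws∈ u∈ w∈ws

    separate-concatˡ : ∀ {vss ws} → All (λ vs → Separate vs ws) vss → Separate (concat vss) ws
    separate-concatˡ {vss = vss} sep u∈ w∈ with ∈-concat⁻′ vss u∈
    ... | vs , u∈vs , vs∈ = All.lookup sep vs∈ u∈vs w∈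

    -- `components-parts` speaks of `raw` only. Atomicity and disjointness depend on nothing else,
    -- so both transfer without comparing proofs of `IsDrag`.
    record SumOf (vss : List (List 𝓥)) : Set where
      field
        expr             : Expr
        value-expr       : value expr ≐ part (concat vss)
        components-parts : map raw (components expr) ≡ map part vss

    sumOf : ∀ {vss} → All (IsDrag ∘ part) vss → AllPairs Separate vss → SumOf vss
    sumOf []              []            = record
      -- Ending every sum in `emptySum` covers a factor without summands, such as the right one when
      -- `D` has no edges.
      { expr             = emptySum
      ; value-expr       = record { V-≡ = refl ; R-≡ = λ () ; L-≡ = λ () ; X-≡ = λ () }
      ; components-parts = refl
      }
    sumOf (drag ∷ drags) (sep ∷ seps)   = record
      { expr             = sumExpr (component D) (SumOf.expr ih)
          (Disjoint-resp-≐ part≐ (SumOf.value-expr ih) (separate⇒disjoint (separate-concatʳ sep)))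
      ; value-expr       = ⊕-part part≐ (SumOf.value-expr ih)
      ; components-parts = cong (_ ∷_) (SumOf.components-parts ih)
      }
      where
      ih = sumOf drags seps

      D : Drag
      D = record { raw = _ ; isDrag = drag }

      part≐ : raw D ≐ raw D
      part≐ = record { V-≡ = refl ; R-≡ = λ _ → refl ; L-≡ = λ _ → refl ; X-≡ = λ _ → refl }

  -- Redirecting the edges of a drag

  module Redirection (V₀ : List 𝓥) {Edge : Set} (_≟ᴱ_ : DecidableEquality Edge)
                     (out : 𝓥 → List Edge) where

    open DecMembership _≟ᴱ_ using () renaming (_∈?_ to _∈ᴱ?_)

    E : List Edge
    E = concatMap out V₀

    ∈-out⇒∈-E : ∀ {v e} → v ∈ V₀ → e ∈ out v → e ∈ E
    ∈-out⇒∈-E v∈ e∈ = ∈-concatMap⁺ out (lose v∈ e∈)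

    -- The invariant of the wiring: the edges stay indexed by `E`, and only their current heads `hd`
    -- vary. `leaves` are the auxiliary sprouts not yet removed. The vertices are given up to order
    -- because a sum lists them component by component.
    record HasHeads (D : RawDrag) (hd : Edge → 𝓥) (leaves : List 𝓥) : Set where
      field
        V-↭    : V D ↭ V₀ ++ leaves
        X-V₀   : ∀ {v} → v ∈ V₀ → X D v ≡ map hd (out v)
        X-leaf : ∀ {v} → v ∈ leaves → X D v ≡ []

    HasHeads-cong : ∀ {D hd hd′ leaves} → (∀ {e} → e ∈ E → hd e ≡ hd′ e) →
                    HasHeads D hd leaves → HasHeads D hd′ leaves
    HasHeads-cong hd≡hd′ D-hd = record
      { V-↭    = V-↭
      ; X-V₀   = λ v∈ → trans (X-V₀ v∈)
          (map-cong-local (All.tabulate λ e∈ → hd≡hd′ (∈-out⇒∈-E v∈ e∈)))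
      ; X-leaf = X-leaf
      }
      where open HasHeads D-hd

    -- Permuting the vertices permutes the edges, and leaves contribute none, so in-degrees can be
    -- read off `hd`.
    pred-count : ∀ {D hd leaves} → HasHeads D hd leaves → ∀ u →
                 pred u D ≡ count (λ e → hd e ≟ u) E
    pred-count {D} {hd} {leaves} D-hd u = begin
      count into? (edges D)
        ≡⟨ ↭.↭-length (↭.filter-↭ into? (concatMap-↭ succs V-↭)) ⟩
      count into? (concatMap succs (V₀ ++ leaves))
        ≡⟨ cong (count into?) (concatMap-++ succs V₀ leaves) ⟩
      count into? (concatMap succs V₀ ++ concatMap succs leaves)
        ≡⟨ cong (λ es → count into? (concatMap succs V₀ ++ es))
             (concatMap-[] leaves λ {v} v∈ → cong (map (v ,_)) (X-leaf v∈)) ⟩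
      count into? (concatMap succs V₀ ++ [])
        ≡⟨ cong (count into?) (++-identityʳ (concatMap succs V₀)) ⟩
      count into? (concatMap succs V₀)
        ≡⟨ count-concatMap into? (λ e → hd e ≟ u) succs out V₀ atVertex ⟩
      count (λ e → hd e ≟ u) E ∎
      where
      open ≡-Reasoning
      open HasHeads D-hd

      succs : 𝓥 → List (𝓥 × 𝓥)
      succs v = map (v ,_) (X D v)

      into? : Decidable (λ (e : 𝓥 × 𝓥) → proj₂ e ≡ u)
      into? e = proj₂ e ≟ u

      atVertex : ∀ {v} → v ∈ V₀ →
                 count into? (succs v) ≡ count (λ e → hd e ≟ u) (out v)
      atVertex {v} v∈ = begin
        count into? (map (v ,_) (X D v)) ≡⟨ count-map into? (v ,_) (X D v) ⟩
        count (_≟ u) (X D v)             ≡⟨ cong (count (_≟ u)) (X-V₀ v∈) ⟩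
        count (_≟ u) (map hd (out v))    ≡⟨ count-map (_≟ u) hd (out v) ⟩
        count (λ e → hd e ≟ u) (out v)   ∎

    step-HasHeads : ∀ {D hd s r leaves} → s ∉ V₀ → s ∉ leaves → HasHeads D hd (s ∷ leaves) →
      HasHeads (D [ s ⇝ r ]) (λ e → if does (hd e ≟ s) then r else hd e) leaves
    step-HasHeads {D} {hd} {s} {r} {leaves} s∉V₀ s∉leaves D-hd = record
      { V-↭    = ↭-trans (↭.filter-↭ ≢s? V-↭) (↭-reflexive removeS)
      ; X-V₀   = λ v∈ → trans (cong (map _) (X-V₀ v∈)) (sym (map-∘ _))
      ; X-leaf = λ v∈ → cong (map _) (X-leaf (there v∈))
      }
      where
      open HasHeads D-hd

      ≢s? : Decidable (_≢ s)
      ≢s? v = ¬? (v ≟ s)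

      keep : ∀ {vs} → s ∉ vs → filter ≢s? vs ≡ vs
      keep s∉vs = filter-all ≢s? (All.tabulate λ { v∈ refl → s∉vs v∈ })

      removeS : filter ≢s? (V₀ ++ s ∷ leaves) ≡ V₀ ++ leaves
      removeS = trans (filter-++ ≢s? V₀ (s ∷ leaves))
        (cong₂ _++_ (keep s∉V₀)
          (trans (filter-reject ≢s? {s} (λ s≢s → s≢s refl)) (keep s∉leaves)))

    -- One batch of wires, moving each edge from its own sprout `a e` to `b e`

    module _ (E-unique : Unique E) (a b : Edge → 𝓥)
             (a-inj : InjectiveOn E a) (a∉V₀ : ∀ {e} → e ∈ E → a e ∉ V₀)
             (a≢b : ∀ {e e′} → e ∈ E → e′ ∈ E → a e ≢ b e′) where

      wire : Edge → 𝓥 × 𝓥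
      wire e = a e , b e

      private
        -- The heads while the wires of the edges in es are still to be processed.
        mixed : List Edge → Edge → 𝓥
        mixed es e = if does (e ∈ᴱ? es) then a e else b e

        -- Only `e₀` currently ends in `a e₀`: the other pending edges end in other sprouts as `a`
        -- is injective, and the finished ones end in values of `b`, none of which is a wired
        -- sprout.
        mixed-step : ∀ {e₀ es e} → e₀ ∉ es → e₀ ∈ E → e ∈ E →
          (if does (mixed (e₀ ∷ es) e ≟ a e₀) then b e₀ else mixed (e₀ ∷ es) e) ≡ mixed es e
        mixed-step {e₀} {es} {e} e₀∉es e₀∈E e∈E with e ≟ᴱ e₀ | e ∈ᴱ? es
        ... | yes refl | yes e∈es = contradiction e∈es e₀∉es
        ... | yes refl | no _     rewrite dec-true (a e ≟ a e) refl = refl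
        ... | no e≢e₀  | yes _    rewrite dec-false (a e ≟ a e₀) (e≢e₀ ∘ a-inj e∈E e₀∈E) = refl
        ... | no _     | no _     rewrite dec-false (b e ≟ a e₀) (a≢b e₀∈E e∈E ∘ sym) = refl

        pred-mixed : ∀ {e₀ leaves D} es → e₀ ∈ E → HasHeads D (mixed (e₀ ∷ es)) leaves →
                     pred (a e₀) D ≡ 1
        pred-mixed {e₀} {D = D} es e₀∈E D-hd = trans (pred-count D-hd (a e₀))
          (ℕ.≤-antisym (count-unique P? E-unique (λ x∈ y∈ p q → trans (only x∈ p) (sym (only y∈ q))))
                       (filter-some P? (lose e₀∈E isA)))
          where
          P? : Decidable (λ e → mixed (e₀ ∷ es) e ≡ a e₀)
          P? e = mixed (e₀ ∷ es) e ≟ a e₀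

          isA : mixed (e₀ ∷ es) e₀ ≡ a e₀
          isA rewrite dec-true (e₀ ≟ᴱ e₀) refl = refl

          only : ∀ {e} → e ∈ E → mixed (e₀ ∷ es) e ≡ a e₀ → e ≡ e₀
          only {e} e∈ eq with e ≟ᴱ e₀ | e ∈ᴱ? es | eq
          ... | yes e≡e₀ | _     | _   = e≡e₀
          ... | no  _    | yes _ | eq′ = a-inj e∈ e₀∈E eq′
          ... | no  _    | no  _ | eq′ = contradiction (sym eq′) (a≢b e₀∈E e∈)

        -- Truncated subtractions accumulate, `m ∸ 1 ∸ n ≡ m ∸ (1 + n)`, so the roots lost at `r`
        -- add up to one count of edges.
        R-step : ∀ {D} e₀ es r → pred (a e₀) D ≡ 1 →
          R (step D (wire e₀)) r ∸ count (λ e → b e ≟ r) es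
            ≡ R D r ∸ count (λ e → b e ≟ r) (e₀ ∷ es)
        R-step {D} e₀ es r pred≡1 with b e₀ ≟ r
        ... | yes refl rewrite dec-true (r ≟ r) refl | pred≡1 = ℕ.∸-+-assoc (R D r) 1 _
        ... | no b≢r   rewrite dec-false (r ≟ b e₀) (b≢r ∘ sym) = refl

        -- Generalizes `redirect` to the edges `es` still pending, so that the induction can start
        -- in the middle of the batch; `map a es` are the sprouts of the batch that remain.
        redirectSome : ∀ es {D leaves} → (∀ {e} → e ∈ es → e ∈ E) →
          Unique (map a es ++ leaves) → HasHeads D (mixed es) (map a es ++ leaves) →
          HasHeads (foldl step D (map wire es)) b leaves ×
          (∀ r → R (foldl step D (map wire es)) r ≡ R D r ∸ count (λ e → b e ≟ r) es)
        redirectSome []       es⊆E _                 D-hd = D-hd , λ _ → refl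
        redirectSome (e ∷ es) {D} {leaves} es⊆E (ae∉ ∷ rest!) D-hd =
          proj₁ ih , λ r → trans (proj₂ ih r) (R-step {D} e es r (pred-mixed es e∈E D-hd))
          where
          e∈E : e ∈ E
          e∈E = es⊆E (here refl)

          ae∉rest : a e ∉ map a es ++ leaves
          ae∉rest ae∈ = All.lookup ae∉ ae∈ refl

          e∉es : e ∉ es
          e∉es e∈es = ae∉rest (∈-++⁺ˡ (∈-map⁺ a e∈es))

          ih = redirectSome es (es⊆E ∘ there) rest!
            (HasHeads-cong (mixed-step e∉es e∈E)
              (step-HasHeads (a∉V₀ e∈E) ae∉rest D-hd))

      redirect : ∀ {D leaves} → Unique (map a E ++ leaves) → HasHeads D a (map a E ++ leaves) →
        HasHeads (foldl step D (map wire E)) b leaves ×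
        (∀ r → R (foldl step D (map wire E)) r ≡ R D r ∸ count (λ e → b e ≟ r) E)
      redirect leaves! D-hd = redirectSome E id leaves! (HasHeads-cong a≡mixed D-hd)
        where
        a≡mixed : ∀ {e} → e ∈ E → a e ≡ mixed E e
        a≡mixed {e} e∈E rewrite dec-true (e ∈ᴱ? E) e∈E = refl

  -- The decomposition

  module Decomposition (D : Drag) where

    open IsDrag (isDrag D)

    D₀ : RawDrag
    D₀ = raw D

    V₀ : List 𝓥
    V₀ = V D₀

    -- The middle entry is the position in the successor list. It keeps parallel edges apart, so
    -- that each gets its own pair of sprouts.
    Edge : Set
    Edge = 𝓥 × ℕ × 𝓥

    tail head : Edge → 𝓥
    tail e = proj₁ e
    head e = proj₂ (proj₂ e)

    _≟ᴱ_ : DecidableEquality Edge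
    _≟ᴱ_ = ≡-dec _≟_ (≡-dec ℕ._≟_ _≟_)

    out : 𝓥 → List Edge
    out v = tabulate λ i → v , toℕ i , lookup (X D₀ v) i

    open Redirection V₀ _≟ᴱ_ out

    head-out : ∀ v → map head (out v) ≡ X D₀ v
    head-out v = trans (map-tabulate _ head) (tabulate-lookup (X D₀ v))

    length-out : ∀ v → length (out v) ≡ length (X D₀ v)
    length-out v = length-tabulate _

    tail-out : ∀ {v e} → e ∈ out v → tail e ≡ v
    tail-out e∈ with ∈-tabulate⁻ e∈
    ... | _ , refl = refl

    out-unique : ∀ v → Unique (out v)
    out-unique v = Unique.tabulate⁺ (toℕ-injective ∘ cong (proj₁ ∘ proj₂))

    E-unique : Unique E
    E-unique = Unique.concat⁺
      (All.map⁺ (All.tabulate λ {v} _ → out-unique v))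
      (AllPairs.map⁺ (AllPairs.map
        (λ v≢w → λ { (e∈v , e∈w) → v≢w (trans (sym (tail-out e∈v)) (tail-out e∈w)) })
        V-unique))

    ∈-E⁻ : ∀ {e} → e ∈ E → ∃ λ v → v ∈ V₀ × e ∈ out v
    ∈-E⁻ e∈ = find (∈-concatMap⁻ out e∈)

    head∈V₀ : ∀ {e} → e ∈ E → head e ∈ V₀
    head∈V₀ e∈ with ∈-E⁻ e∈
    ... | v , v∈ , e∈out = X-closed v∈ (∈-resp-≡ (head-out v) (∈-map⁺ head e∈out))

    sprout-out : ∀ {v x} → v ∈ V₀ → L D₀ v ≡ inj₂ x → out v ≡ []
    sprout-out {v} v∈ Lv = length≡0 (trans (length-out v) (trans (X-arity v∈) (cong labelArity Lv)))
      where
      length≡0 : ∀ {es : List Edge} → length es ≡ 0 → es ≡ []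
      length≡0 {[]} _ = refl

    -- Labels

    isFunction? : (l : Label) → Dec (∃ λ f → l ≡ inj₁ f)
    isFunction? (inj₁ f) = yes (f , refl)
    isFunction? (inj₂ x) = no λ ()

    isVariable? : ∀ x (l : Label) → Dec (l ≡ inj₂ x)
    isVariable? x (inj₁ f) = no λ ()
    isVariable? x (inj₂ y) with y ≟ˣ x
    ... | yes refl = yes refl
    ... | no y≢x   = no λ { refl → y≢x refl }

    inj₁≢inj₂ : ∀ {l : Label} {f x} → l ≡ inj₁ f → l ≢ inj₂ x
    inj₁≢inj₂ refl ()

    inj₂-unique : ∀ {l : Label} {x y} → l ≡ inj₂ x → l ≡ inj₂ y → x ≡ y
    inj₂-unique refl refl = refl

    variables : Label → List 𝓧
    variables (inj₁ f) = []
    variables (inj₂ x) = x ∷ []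

    vars : List 𝓧
    vars = concatMap (variables ∘ L D₀) V₀

    ∈-vars⁺ : ∀ {v x} → SproutLabelled D₀ v x → x ∈ vars
    ∈-vars⁺ {v} {x} (v∈ , Lv) = ∈-concatMap⁺ (variables ∘ L D₀)
      (lose v∈ (subst (λ l → x ∈ variables l) (sym Lv) (here refl)))

    ∈-variables⁻ : ∀ l {x} → x ∈ variables l → l ≡ inj₂ x
    ∈-variables⁻ (inj₂ x) (here refl) = refl

    ∈-vars⁻ : ∀ {x} → x ∈ vars → ∃ λ v → SproutLabelled D₀ v x
    ∈-vars⁻ x∈ with find (∈-concatMap⁻ (variables ∘ L D₀) {V₀} x∈)
    ... | v , v∈ , x∈v = v , v∈ , ∈-variables⁻ (L D₀ v) x∈v

    -- Fresh sprouts and variables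

    private
      s-fresh = fresh _≟ᴱ_ 𝓥-inf V₀ E

    s : Edge → 𝓥
    s = proj₁ s-fresh

    s∉V₀ : ∀ {e} → e ∈ E → s e ∉ V₀
    s∉V₀ = proj₁ (proj₂ s-fresh)

    s-inj : InjectiveOn E s
    s-inj = proj₂ (proj₂ s-fresh)

    private
      t-fresh = fresh _≟ᴱ_ 𝓥-inf (V₀ ++ map s E) E

    t : Edge → 𝓥
    t = proj₁ t-fresh

    t∉V₀ : ∀ {e} → e ∈ E → t e ∉ V₀
    t∉V₀ e∈ = proj₁ (proj₂ t-fresh) e∈ ∘ ∈-++⁺ˡ

    s≢t : ∀ {e e′} → e ∈ E → e′ ∈ E → s e ≢ t e′
    s≢t e∈ e′∈ eq = proj₁ (proj₂ t-fresh) e′∈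
      (∈-++⁺ʳ V₀ (subst (_∈ map s E) eq (∈-map⁺ s e∈)))

    t-inj : InjectiveOn E t
    t-inj = proj₂ (proj₂ t-fresh)

    s≢head : ∀ {e e′} → e ∈ E → e′ ∈ E → s e ≢ head e′
    s≢head e∈ e′∈ eq = s∉V₀ e∈ (subst (_∈ V₀) (sym eq) (head∈V₀ e′∈))

    t≢head : ∀ {e e′} → e ∈ E → e′ ∈ E → t e ≢ head e′
    t≢head e∈ e′∈ eq = t∉V₀ e∈ (subst (_∈ V₀) (sym eq) (head∈V₀ e′∈))

    new : List 𝓥
    new = map s E ++ map t E

    data New : 𝓥 → Set where
      new-s : ∀ {e} → e ∈ E → New (s e)
      new-t : ∀ {e} → e ∈ E → New (t e)

    ∈-new⁻ : ∀ {u} → u ∈ new → New u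
    ∈-new⁻ u∈ with ∈-++⁻ (map s E) u∈
    ... | inj₁ u∈s with _ , e∈ , refl ← ∈-map⁻ s u∈s = new-s e∈
    ... | inj₂ u∈t with _ , e∈ , refl ← ∈-map⁻ t u∈t = new-t e∈

    ∈-new⁺ : ∀ {u} → New u → u ∈ new
    ∈-new⁺ (new-s e∈) = ∈-++⁺ˡ (∈-map⁺ s e∈)
    ∈-new⁺ (new-t e∈) = ∈-++⁺ʳ (map s E) (∈-map⁺ t e∈)

    new∉V₀ : ∀ {u} → New u → u ∉ V₀
    new∉V₀ (new-s e∈) = s∉V₀ e∈
    new∉V₀ (new-t e∈) = t∉V₀ e∈

    s-unique : Unique (map s E)
    s-unique = map-unique s-inj E-unique

    t-unique : Unique (map t E)
    t-unique = map-unique t-inj E-unique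

    new-unique : Unique new
    new-unique = Unique.++⁺ s-unique t-unique disjoint-st
      where
      disjoint-st : ∀ {u} → ¬ (u ∈ map s E × u ∈ map t E)
      disjoint-st (u∈s , u∈t) with ∈-map⁻ s u∈s | ∈-map⁻ t u∈t
      ... | _ , e∈ , refl | _ , e′∈ , eq = s≢t e∈ e′∈ eq

    private
      ψ-fresh = fresh _≟_ 𝓧-inf vars new

    ψ : 𝓥 → 𝓧
    ψ = proj₁ ψ-fresh

    ψ∉vars : ∀ {u} → New u → ψ u ∉ vars
    ψ∉vars = proj₁ (proj₂ ψ-fresh) ∘ ∈-new⁺

    ψ-inj : ∀ {u w} → New u → New w → ψ u ≡ ψ w → u ≡ w
    ψ-inj u w = proj₂ (proj₂ ψ-fresh) (∈-new⁺ u) (∈-new⁺ w)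

    -- The common roots, labels and successors of all components

    extend : ∀ {A : Set} → (𝓥 → A) → (𝓥 → A) → 𝓥 → A
    extend f g v = if does (v ∈? V₀) then f v else g v

    extend-V₀ : ∀ {A : Set} (f g : 𝓥 → A) {v} → v ∈ V₀ → extend f g v ≡ f v
    extend-V₀ f g {v} v∈ rewrite dec-true (v ∈? V₀) v∈ = refl

    extend-new : ∀ {A : Set} (f g : 𝓥 → A) {v} → New v → extend f g v ≡ g v
    extend-new f g {v} v-new rewrite dec-false (v ∈? V₀) (new∉V₀ v-new) = refl

    indegree : 𝓥 → ℕ
    indegree v = count (λ e → head e ≟ v) E

    -- All components take R, L and X from M and differ only in their vertices.
    -- The extra roots on V₀ are those that the wirings consume.
    M : RawDrag
    M = record
      { V = V₀ ++ new
      ; R = extend (λ v → R D₀ v + indegree v) (λ _ → 1)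
      ; L = extend (L D₀) (inj₂ ∘ ψ)
      ; X = extend (map s ∘ out) (λ _ → [])
      }

    open Parts M

    V₀⊆M : ∀ {v} → v ∈ V₀ → v ∈ V M
    V₀⊆M = ∈-++⁺ˡ

    new⊆M : ∀ {v} → New v → v ∈ V M
    new⊆M v = ∈-++⁺ʳ V₀ (∈-new⁺ v)

    ∈-M⁻ : ∀ {v} → v ∈ V M → v ∈ V₀ ⊎ New v
    ∈-M⁻ v∈ with ∈-++⁻ V₀ v∈
    ... | inj₁ v∈V₀  = inj₁ v∈V₀
    ... | inj₂ v∈new = inj₂ (∈-new⁻ v∈new)

    L-V₀ : ∀ {v} → v ∈ V₀ → L M v ≡ L D₀ v
    L-V₀ = extend-V₀ (L D₀) (inj₂ ∘ ψ)

    L-new : ∀ {v} → New v → L M v ≡ inj₂ (ψ v)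
    L-new = extend-new (L D₀) (inj₂ ∘ ψ)

    X-V₀ : ∀ {v} → v ∈ V₀ → X M v ≡ map s (out v)
    X-V₀ = extend-V₀ (map s ∘ out) _

    X-new : ∀ {v} → New v → X M v ≡ []
    X-new = extend-new (map s ∘ out) _

    R-V₀ : ∀ {v} → v ∈ V₀ → R M v ≡ R D₀ v + indegree v
    R-V₀ = extend-V₀ (λ v → R D₀ v + indegree v) _

    R-new : ∀ {v} → New v → R M v ≡ 1
    R-new = extend-new (λ v → R D₀ v + indegree v) _

    X-arity-M : ∀ {v} → v ∈ V M → length (X M v) ≡ labelArity (L M v)
    X-arity-M {v} v∈ with ∈-M⁻ v∈
    ... | inj₂ v-new = trans (cong length (X-new v-new)) (cong labelArity (sym (L-new v-new)))
    ... | inj₁ v∈V₀  = begin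
      length (X M v)         ≡⟨ cong length (X-V₀ v∈V₀) ⟩
      length (map s (out v)) ≡⟨ length-map s (out v) ⟩
      length (out v)         ≡⟨ length-out v ⟩
      length (X D₀ v)        ≡⟨ X-arity v∈V₀ ⟩
      labelArity (L D₀ v)    ≡⟨ cong labelArity (L-V₀ v∈V₀) ⟨
      labelArity (L M v)     ∎
      where open ≡-Reasoning

    sprout-X : ∀ {v x} → v ∈ V₀ → L D₀ v ≡ inj₂ x → X M v ≡ []
    sprout-X v∈ Lv = trans (X-V₀ v∈) (cong (map s) (sprout-out v∈ Lv))

    part-isDrag : ∀ {vs} → Unique vs → (∀ {v} → v ∈ vs → v ∈ V M) →
                  (∀ {v w} → v ∈ vs → w ∈ X M v → w ∈ vs) → IsDrag (part vs)
    part-isDrag vs! vs⊆M closed = record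
      { V-unique = vs!
      ; X-arity  = X-arity-M ∘ vs⊆M
      ; X-closed = closed
      }

    -- `ψ` avoids the variables of `D` and is injective on the new sprouts. This one fact yields the
    -- distinct labels inside an atom, the separation of new sprouts from other components, and
    -- coherence.
    new-label : ∀ {u w x} → New u → w ∈ V M → L M u ≡ inj₂ x → L M w ≡ inj₂ x → u ≡ w
    new-label u-new w∈ Lu Lw
      with refl ← inj₂-unique (L-new u-new) Lu | ∈-M⁻ w∈
    ... | inj₁ w∈V₀  = contradiction (∈-vars⁺ (w∈V₀ , trans (sym (L-V₀ w∈V₀)) Lw)) (ψ∉vars u-new)
    ... | inj₂ w-new = ψ-inj u-new w-new (inj₂-unique Lw (L-new w-new))

    apart-sym : ∀ {u w} → Apart u w → Apart w u
    apart-sym (u≢w , labels) = u≢w ∘ sym , λ Lw Lu → labels Lu Lw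

    apart-new : ∀ {u w} → New u → w ∈ V M → u ≢ w → Apart u w
    apart-new u-new w∈ u≢w = u≢w , λ Lu Lw → u≢w (new-label u-new w∈ Lu Lw)

    apart-function : ∀ {u w f} → u ∈ V₀ → L D₀ u ≡ inj₁ f → u ≢ w → Apart u w
    apart-function u∈ Lu u≢w = u≢w , λ Lu′ _ → inj₁≢inj₂ (trans (L-V₀ u∈) Lu) Lu′

    ∈⇒≢ : ∀ {u w} → u ∈ V₀ → w ∉ V₀ → u ≢ w
    ∈⇒≢ u∈ w∉ refl = w∉ u∈

    -- Atoms

    atom : 𝓥 → List 𝓥
    atom v = v ∷ map s (out v)

    sproutSet : 𝓧 → List 𝓥
    sproutSet x = filter (λ v → isVariable? x (L D₀ v)) V₀

    internals : List 𝓥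
    internals = filter (λ v → isFunction? (L D₀ v)) V₀

    sproutNames : List 𝓧
    sproutNames = deduplicate _≟ˣ_ vars

    left right : List (List 𝓥)
    left  = map atom internals ++ map sproutSet sproutNames
    right = map [_] (map t E)

    ∈-internals⁻ : ∀ {v} → v ∈ internals → v ∈ V₀ × ∃ λ f → L D₀ v ≡ inj₁ f
    ∈-internals⁻ = ∈-filter⁻ (λ v → isFunction? (L D₀ v))

    ∈-sproutSet⁻ : ∀ x {v} → v ∈ sproutSet x → SproutLabelled D₀ v x
    ∈-sproutSet⁻ x = ∈-filter⁻ (λ v → isVariable? x (L D₀ v))

    data InAtom (v : 𝓥) : 𝓥 → Set where
      root : InAtom v v
      leaf : ∀ {e} → e ∈ out v → InAtom v (s e)

    ∈-atom⁻ : ∀ {u v} → u ∈ atom v → InAtom v u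
    ∈-atom⁻ (here refl) = root
    ∈-atom⁻ (there u∈) with _ , e∈ , refl ← ∈-map⁻ s u∈ = leaf e∈

    s-out-inj : ∀ {v} → v ∈ V₀ → InjectiveOn (out v) s
    s-out-inj v∈ e∈ e′∈ = s-inj (∈-out⇒∈-E v∈ e∈) (∈-out⇒∈-E v∈ e′∈)

    s-out-unique : ∀ {v} → v ∈ V₀ → Unique (map s (out v))
    s-out-unique {v} v∈ = map-unique (s-out-inj v∈) (out-unique v)

    atom-isDrag : ∀ {v} → v ∈ V₀ → IsDrag (part (atom v))
    atom-isDrag {v} v∈ = part-isDrag (v∉ ∷ s-out-unique v∈) (known ∘ ∈-atom⁻) (closed ∘ ∈-atom⁻)
      where
      v∉ : All (v ≢_) (map s (out v))
      v∉ = All.map⁺ (All.tabulate λ e∈ → ∈⇒≢ v∈ (s∉V₀ (∈-out⇒∈-E v∈ e∈)))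

      known : ∀ {u} → InAtom v u → u ∈ V M
      known root      = V₀⊆M v∈
      known (leaf e∈) = new⊆M (new-s (∈-out⇒∈-E v∈ e∈))

      closed : ∀ {u w} → InAtom v u → w ∈ X M u → w ∈ atom v
      closed root      w∈ = there (∈-resp-≡ (X-V₀ v∈) w∈)
      closed (leaf e∈) w∈ with () ← ∈-resp-≡ (X-new (new-s (∈-out⇒∈-E v∈ e∈))) w∈

    sproutSet-isDrag : ∀ x → IsDrag (part (sproutSet x))
    sproutSet-isDrag x = part-isDrag
      (Unique.filter⁺ (λ v → isVariable? x (L D₀ v)) V-unique)
      (V₀⊆M ∘ proj₁ ∘ ∈-sproutSet⁻ x)
      λ {v} {w} v∈ w∈ → let v∈V₀ , Lv = ∈-sproutSet⁻ x v∈ in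
        contradiction (∈-resp-≡ (sprout-X v∈V₀ Lv) w∈) λ ()

    [new]-isDrag : ∀ {u} → New u → IsDrag (part [ u ])
    [new]-isDrag u-new = part-isDrag ([] ∷ []) (λ { (here refl) → new⊆M u-new })
      λ { (here refl) w∈ → contradiction (∈-resp-≡ (X-new u-new) w∈) λ () }

    atom-isAtomic : ∀ {v f} → v ∈ V₀ → L D₀ v ≡ inj₁ f → IsAtomicVertex (part (atom v))
    atom-isAtomic {v} v∈ Lv = record
      { vertex            = v
      ; internal          = here refl , _ , trans (L-V₀ v∈) Lv
      ; internal-unique   = λ (u∈ , _ , Lu) → internal (∈-atom⁻ u∈) Lu
      ; sprouts-are-succs = λ (_ , u∈ , Lu) → sprout (∈-atom⁻ u∈) Lu
      ; succs-are-sprouts = subst (All (Sprout (part (atom v)))) (sym X≡)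
          (All.tabulate λ u∈ → isSprout (∈-map⁻ s u∈) (there u∈))
      ; succs-unique      = subst Unique (sym X≡) (s-out-unique v∈)
      ; labels-unique     = subst (Unique ∘ map (L M)) (sym X≡)
          (subst Unique (map-∘ (out v)) (map-unique label-inj (out-unique v)))
      }
      where
      X≡ : X M v ≡ map s (out v)
      X≡ = X-V₀ v∈

      new-leaf : ∀ {e} → e ∈ out v → New (s e)
      new-leaf e∈ = new-s (∈-out⇒∈-E v∈ e∈)

      L-leaf : ∀ {e} → e ∈ out v → L M (s e) ≡ inj₂ (ψ (s e))
      L-leaf e∈ = L-new (new-leaf e∈)

      internal : ∀ {u f} → InAtom v u → L M u ≡ inj₁ f → u ≡ v
      internal root      _  = refl
      internal (leaf e∈) Lu = contradiction (L-leaf e∈) (inj₁≢inj₂ Lu)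

      sprout : ∀ {u x} → InAtom v u → L M u ≡ inj₂ x → u ∈ X M v
      sprout root      Lu = contradiction Lu (inj₁≢inj₂ (trans (L-V₀ v∈) Lv))
      sprout (leaf e∈) _  = ∈-resp-≡ (sym X≡) (∈-map⁺ s e∈)

      isSprout : ∀ {u} → (∃ λ e → e ∈ out v × u ≡ s e) → u ∈ atom v → Sprout (part (atom v)) u
      isSprout (_ , e∈ , refl) u∈ = _ , u∈ , L-leaf e∈

      label-inj : InjectiveOn (out v) (L M ∘ s)
      label-inj e∈ e′∈ eq = s-out-inj v∈ e∈ e′∈
        (new-label (new-leaf e∈) (new⊆M (new-leaf e′∈)) (L-leaf e∈) (trans (sym eq) (L-leaf e∈)))

    sproutSet-isAtomic : ∀ {x} → x ∈ vars → IsAtomicSproutSet (part (sproutSet x))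
    sproutSet-isAtomic {x} x∈ = record
      { variableName = x
      ; nonempty     = let v , v∈ , Lv = ∈-vars⁻ x∈ in
          v , ∈-filter⁺ (λ v → isVariable? x (L D₀ v)) v∈ Lv
      ; all-labelled = λ v∈ → let v∈V₀ , Lv = ∈-sproutSet⁻ x v∈ in trans (L-V₀ v∈V₀) Lv
      }

    [new]-isAtomic : ∀ {u} → New u → IsAtomicSproutSet (part [ u ])
    [new]-isAtomic {u} u-new = record
      { variableName = ψ u
      ; nonempty     = u , here refl
      ; all-labelled = λ { (here refl) → L-new u-new }
      }

    AtomicPart : List 𝓥 → Set
    AtomicPart vs = IsAtomicVertex (part vs) ⊎ IsAtomicSproutSet (part vs)

    ∈-sproutNames⁻ : ∀ {x} → x ∈ sproutNames → x ∈ vars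
    ∈-sproutNames⁻ = ∈-deduplicate⁻ _≟ˣ_ vars

    left-drags : All (IsDrag ∘ part) left
    left-drags = All.++⁺
      (All.map⁺ (All.tabulate (atom-isDrag ∘ proj₁ ∘ ∈-internals⁻)))
      (All.map⁺ (All.tabulate λ {x} _ → sproutSet-isDrag x))

    left-atomic : All AtomicPart left
    left-atomic = All.++⁺
      (All.map⁺ (All.tabulate λ v∈ → let v∈V₀ , _ , Lv = ∈-internals⁻ v∈ in
        inj₁ (atom-isAtomic v∈V₀ Lv)))
      (All.map⁺ (All.tabulate (inj₂ ∘ sproutSet-isAtomic ∘ ∈-sproutNames⁻)))

    right-drags : All (IsDrag ∘ part) right
    right-drags = All.map⁺ (All.map⁺ (All.tabulate ([new]-isDrag ∘ new-t)))

    right-atomic : All AtomicPart right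
    right-atomic = All.map⁺ (All.map⁺ (All.tabulate (inj₂ ∘ [new]-isAtomic ∘ new-t)))

    -- Separation

    atom-atom : ∀ {v v′} → v ∈ internals → v′ ∈ internals → v ≢ v′ → Separate (atom v) (atom v′)
    atom-atom {v} {v′} v∈ v′∈ v≢v′ u∈ w∈
      with v∈V₀ , _ , Lv ← ∈-internals⁻ v∈ | v′∈V₀ , _ , Lv′ ← ∈-internals⁻ v′∈
      with ∈-atom⁻ u∈ | ∈-atom⁻ w∈
    ... | root    | root     = apart-function v∈V₀ Lv v≢v′
    ... | root    | leaf e∈  = apart-function v∈V₀ Lv (∈⇒≢ v∈V₀ (s∉V₀ (∈-out⇒∈-E v′∈V₀ e∈)))
    ... | leaf e∈ | root     =
      apart-sym (apart-function v′∈V₀ Lv′ (∈⇒≢ v′∈V₀ (s∉V₀ (∈-out⇒∈-E v∈V₀ e∈))))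
    -- A common sprout would belong to one edge with two different tails.
    ... | leaf e∈ | leaf e′∈ = apart-new (new-s e∈E) (new⊆M (new-s e′∈E)) λ eq →
      v≢v′ (trans (sym (tail-out e∈)) (trans (cong tail (s-inj e∈E e′∈E eq)) (tail-out e′∈)))
      where
      e∈E  = ∈-out⇒∈-E v∈V₀ e∈
      e′∈E = ∈-out⇒∈-E v′∈V₀ e′∈

    atom-sproutSet : ∀ {v} x → v ∈ internals → Separate (atom v) (sproutSet x)
    atom-sproutSet x v∈ u∈ w∈
      with v∈V₀ , _ , Lv ← ∈-internals⁻ v∈ | w∈V₀ , Lw ← ∈-sproutSet⁻ x w∈ | ∈-atom⁻ u∈
    ... | root    = apart-function v∈V₀ Lv λ { refl → inj₁≢inj₂ Lv Lw }
    ... | leaf e∈ = apart-new (new-s e∈E) (V₀⊆M w∈V₀) (∈⇒≢ w∈V₀ (s∉V₀ e∈E) ∘ sym)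
      where e∈E = ∈-out⇒∈-E v∈V₀ e∈

    sproutSet-sproutSet : ∀ {x y} → x ≢ y → Separate (sproutSet x) (sproutSet y)
    sproutSet-sproutSet {x} {y} x≢y u∈ w∈
      with u∈V₀ , Lu ← ∈-sproutSet⁻ x u∈ | w∈V₀ , Lw ← ∈-sproutSet⁻ y w∈ =
      (λ { refl → x≢y (inj₂-unique Lu Lw) }) ,
      λ Lu′ Lw′ → x≢y (trans (inj₂-unique (trans (L-V₀ u∈V₀) Lu) Lu′)
                             (inj₂-unique Lw′ (trans (L-V₀ w∈V₀) Lw)))

    left-separate : AllPairs Separate left
    left-separate = AllPairs.++⁺
      (AllPairs.map⁺
        (unique⇒allPairs (Unique.filter⁺ (λ v → isFunction? (L D₀ v)) V-unique) atom-atom))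
      (AllPairs.map⁺
        (unique⇒allPairs (DecUnique.deduplicate-! _≟ˣ_ vars) λ _ _ → sproutSet-sproutSet))
      (All.map⁺ (All.tabulate λ v∈ → All.map⁺ (All.tabulate λ {x} _ → atom-sproutSet x v∈)))

    right-separate : AllPairs Separate right
    right-separate = AllPairs.map⁺ (unique⇒allPairs t-unique separate)
      where
      separate : ∀ {u w} → u ∈ map t E → w ∈ map t E → u ≢ w → Separate [ u ] [ w ]
      separate u∈ w∈ u≢w (here refl) (here refl)
        with ∈-map⁻ t u∈ | ∈-map⁻ t w∈
      ... | _ , e∈ , refl | _ , e′∈ , refl = apart-new (new-t e∈) (new⊆M (new-t e′∈)) u≢w

    data InLeft : 𝓥 → Set where
      old  : ∀ {v} → v ∈ V₀ → InLeft v
      left-s : ∀ {e} → e ∈ E → InLeft (s e)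

    ∈-left⁻ : ∀ {vs u} → vs ∈ left → u ∈ vs → InLeft u
    ∈-left⁻ vs∈ u∈ with ∈-++⁻ (map atom internals) vs∈
    ... | inj₂ vs∈sprouts with x , _ , refl ← ∈-map⁻ sproutSet vs∈sprouts =
      old (proj₁ (∈-sproutSet⁻ x u∈))
    ... | inj₁ vs∈atoms with v , v∈ , refl ← ∈-map⁻ atom vs∈atoms | ∈-atom⁻ u∈
    ...   | root    = old (proj₁ (∈-internals⁻ v∈))
    ...   | leaf e∈ = left-s (∈-out⇒∈-E (proj₁ (∈-internals⁻ v∈)) e∈)

    left-right : ∀ {vs ws} → vs ∈ left → ws ∈ right → Separate vs ws
    left-right vs∈ ws∈ u∈ w∈
      with _ , t∈ , refl ← ∈-map⁻ [_] ws∈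
      with _ , e∈ , refl ← ∈-map⁻ t t∈
      with here refl ← w∈ | ∈-left⁻ vs∈ u∈
    ... | old u∈V₀   = apart-sym (apart-new (new-t e∈) (V₀⊆M u∈V₀) (∈⇒≢ u∈V₀ (t∉V₀ e∈) ∘ sym))
    ... | left-s e′∈ = apart-new (new-s e′∈) (new⊆M (new-t e∈)) (s≢t e′∈ e∈)

    left-all right-all : List 𝓥
    left-all  = concat left
    right-all = concat right

    right-all≡ : right-all ≡ map t E
    right-all≡ = concat-map-[ map t E ]

    ∈-left-all⁻ : ∀ {u} → u ∈ left-all → InLeft u
    ∈-left-all⁻ u∈ with vs , u∈vs , vs∈ ← ∈-concat⁻′ left u∈ = ∈-left⁻ vs∈ u∈vs

    ∈-left-all⁺ : ∀ {u} → InLeft u → u ∈ left-all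
    ∈-left-all⁺ (old {v} v∈) = byLabel (L D₀ v) refl
      where
      byLabel : ∀ l → L D₀ v ≡ l → v ∈ left-all
      byLabel (inj₁ f) Lv = ∈-concat⁺′ (here refl) (∈-++⁺ˡ (∈-map⁺ atom
        (∈-filter⁺ (λ v → isFunction? (L D₀ v)) v∈ (f , Lv))))
      byLabel (inj₂ x) Lv = ∈-concat⁺′
        (∈-filter⁺ (λ v → isVariable? x (L D₀ v)) v∈ Lv)
        (∈-++⁺ʳ (map atom internals) (∈-map⁺ sproutSet
          (∈-deduplicate⁺ _≟ˣ_ (∈-vars⁺ (v∈ , Lv)))))
    ∈-left-all⁺ (left-s {e} e∈) with v , v∈ , e∈out ← ∈-E⁻ e∈ = byLabel (L D₀ v) refl
      where
      byLabel : ∀ l → L D₀ v ≡ l → s e ∈ left-all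
      byLabel (inj₁ f) Lv = ∈-concat⁺′ (there (∈-map⁺ s e∈out)) (∈-++⁺ˡ (∈-map⁺ atom
        (∈-filter⁺ (λ v → isFunction? (L D₀ v)) v∈ (f , Lv))))
      -- Sprouts have no outgoing edges, so the tail of `e` is internal and its atom contains `s e`.
      byLabel (inj₂ x) Lv = contradiction (∈-resp-≡ (sprout-out v∈ Lv) e∈out) λ ()

    all-separate : Separate left-all right-all
    all-separate = separate-concatˡ (All.tabulate λ vs∈ →
      separate-concatʳ (All.tabulate (left-right vs∈)))

    parts-disjoint : AllPairs (λ vs ws → Disjoint (part vs) (part ws)) (left ++ right)
    parts-disjoint = AllPairs.map {R = Separate} separate⇒disjoint
      (AllPairs.++⁺ left-separate right-separate
        (All.tabulate λ vs∈ → All.tabulate (left-right vs∈)))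

    parts-unique : Unique (left-all ++ right-all)
    parts-unique = subst Unique (sym (concat-++ left right)) (Unique.concat⁺
      (All.map IsDrag.V-unique (All.++⁺ left-drags right-drags))
      (AllPairs.map Disjoint.V-disjoint parts-disjoint))

    -- Duplicate-free lists with the same members are permutations of each other. This links the
    -- order by components to the order with `V₀` in front that `HasHeads` asks for.
    vertices-↭ : left-all ++ right-all ↭ V₀ ++ new
    vertices-↭ = ∼bag⇒↭ (unique∧set⇒bag parts-unique V₀-new! (mk⇔ to from))
      where
      V₀-new! : Unique (V₀ ++ new)
      V₀-new! = Unique.++⁺ V-unique new-unique λ (u∈V₀ , u∈new) → new∉V₀ (∈-new⁻ u∈new) u∈V₀

      fromLeft : ∀ {u} → InLeft u → u ∈ V₀ ++ new
      fromLeft (old v∈)    = V₀⊆M v∈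
      fromLeft (left-s e∈) = new⊆M (new-s e∈)

      to : ∀ {u} → u ∈ left-all ++ right-all → u ∈ V₀ ++ new
      to u∈ with ∈-++⁻ left-all u∈
      ... | inj₁ u∈left  = fromLeft (∈-left-all⁻ u∈left)
      ... | inj₂ u∈right with _ , e∈ , refl ← ∈-map⁻ t (∈-resp-≡ right-all≡ u∈right) =
        new⊆M (new-t e∈)

      fromM : ∀ {u} → u ∈ V₀ ⊎ New u → u ∈ left-all ++ right-all
      fromM (inj₁ u∈V₀)        = ∈-++⁺ˡ (∈-left-all⁺ (old u∈V₀))
      fromM (inj₂ (new-s e∈)) = ∈-++⁺ˡ (∈-left-all⁺ (left-s e∈))
      fromM (inj₂ (new-t e∈)) = ∈-++⁺ʳ left-all (∈-resp-≡ (sym right-all≡) (∈-map⁺ t e∈))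

      from : ∀ {u} → u ∈ V₀ ++ new → u ∈ left-all ++ right-all
      from = fromM ∘ ∈-M⁻

    -- The two factors and their sum

    abstract

      leftSum : SumOf left
      leftSum = sumOf left-drags left-separate

      rightSum : SumOf right
      rightSum = sumOf right-drags right-separate

    A B N : RawDrag
    A = value (SumOf.expr leftSum)
    B = value (SumOf.expr rightSum)
    N = A ⊕ B

    A≐ : A ≐ part left-all
    A≐ = SumOf.value-expr leftSum

    B≐ : B ≐ part right-all
    B≐ = SumOf.value-expr rightSum

    N≐ : N ≐ part (left-all ++ right-all)
    N≐ = ⊕-part A≐ B≐

    M⊆parts : ∀ {v} → v ∈ V M → v ∈ left-all ++ right-all
    M⊆parts = ↭.∈-resp-↭ (↭-sym vertices-↭)

    V-N : V N ↭ V M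
    V-N = ↭-trans (↭-reflexive (V-≡ N≐)) vertices-↭

    M⊆N : ∀ {v} → v ∈ V M → v ∈ V N
    M⊆N = ↭.∈-resp-↭ (↭-sym V-N)

    N⊆M : ∀ {v} → v ∈ V N → v ∈ V M
    N⊆M = ↭.∈-resp-↭ V-N

    L-N : ∀ {v} → v ∈ V M → L N v ≡ L M v
    L-N = L-≡ N≐ ∘ M⊆parts

    N-heads : HasHeads N s new
    N-heads = record
      { V-↭    = V-N
      ; X-V₀   = λ v∈ → trans (X-≡ N≐ (M⊆parts (V₀⊆M v∈))) (X-V₀ v∈)
      ; X-leaf = λ v∈ → let v-new = ∈-new⁻ v∈ in
          trans (X-≡ N≐ (M⊆parts (new⊆M v-new))) (X-new v-new)
      }

    -- The wiring

    wiresₗ wiresᵣ W : Wires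
    wiresₗ = map (λ e → s e , t e) E
    wiresᵣ = map (λ e → t e , head e) E
    W      = wiresₗ ++ wiresᵣ

    data IsW : 𝓥 × 𝓥 → Set where
      s⇝t    : ∀ {e} → e ∈ E → IsW (s e , t e)
      t⇝head : ∀ {e} → e ∈ E → IsW (t e , head e)

    ∈-W⁻ : ∀ {w} → w ∈ W → IsW w
    ∈-W⁻ w∈ with ∈-++⁻ wiresₗ w∈
    ... | inj₁ w∈ₗ with _ , e∈ , refl ← ∈-map⁻ (λ e → s e , t e) w∈ₗ    = s⇝t e∈
    ... | inj₂ w∈ᵣ with _ , e∈ , refl ← ∈-map⁻ (λ e → t e , head e) w∈ᵣ = t⇝head e∈

    ∈-W⁺ : ∀ {w} → IsW w → w ∈ W
    ∈-W⁺ (s⇝t e∈)    = ∈-++⁺ˡ (∈-map⁺ (λ e → s e , t e) e∈)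
    ∈-W⁺ (t⇝head e∈) = ∈-++⁺ʳ wiresₗ (∈-map⁺ (λ e → t e , head e) e∈)

    -- The equation `a ≡ s e` is a separate argument because `s` is not a constructor: a case split
    -- on `IsW (s e , r)` would get stuck on unifying values of `s` and `t`.
    s-wire : ∀ {e a r} → e ∈ E → a ≡ s e → IsW (a , r) → r ≡ t e
    s-wire e∈ eq (s⇝t e′∈)    = cong t (s-inj e′∈ e∈ eq)
    s-wire e∈ eq (t⇝head e′∈) = contradiction (sym eq) (s≢t e∈ e′∈)

    t-wire : ∀ {e a r} → e ∈ E → a ≡ t e → IsW (a , r) → r ≡ head e
    t-wire e∈ eq (s⇝t e′∈)    = contradiction eq (s≢t e′∈ e∈)
    t-wire e∈ eq (t⇝head e′∈) = cong head (t-inj e′∈ e∈ eq)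

    origin-new : ∀ {a r} → IsW (a , r) → New a
    origin-new (s⇝t e∈)    = new-s e∈
    origin-new (t⇝head e∈) = new-t e∈

    Origin⇒New : ∀ {a} → Origin W a → New a
    Origin⇒New a∈ with _ , w∈ , refl ← ∈-map⁻ proj₁ a∈ = origin-new (∈-W⁻ w∈)

    New⇒Origin : ∀ {a} → New a → Origin W a
    New⇒Origin (new-s e∈) = ∈-map⁺ proj₁ (∈-W⁺ (s⇝t e∈))
    New⇒Origin (new-t e∈) = ∈-map⁺ proj₁ (∈-W⁺ (t⇝head e∈))

    ¬above-V₀ : ∀ {v u} → v ∈ V₀ → ¬ (v >[ W ] u)
    ¬above-V₀ v∈ [ w∈ ]⁺  = new∉V₀ (origin-new (∈-W⁻ w∈)) v∈
    ¬above-V₀ v∈ (w∈ ∷ _) = new∉V₀ (origin-new (∈-W⁻ w∈)) v∈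

    above-t : ∀ {e u} → e ∈ E → t e >[ W ] u → u ≡ head e
    above-t e∈ [ w∈ ]⁺  = t-wire e∈ refl (∈-W⁻ w∈)
    above-t e∈ (w∈ ∷ p) with refl ← t-wire e∈ refl (∈-W⁻ w∈) =
      contradiction p (¬above-V₀ (head∈V₀ e∈))

    -- Chains stop at `head e`: it lies in `V₀` and so is no origin, even when it is a sprout of
    -- `D`.
    above-s : ∀ {e u} → e ∈ E → s e >[ W ] u → u ≡ t e ⊎ u ≡ head e
    above-s e∈ [ w∈ ]⁺  = inj₁ (s-wire e∈ refl (∈-W⁻ w∈))
    above-s e∈ (w∈ ∷ p) with refl ← s-wire e∈ refl (∈-W⁻ w∈) = inj₂ (above-t e∈ p)

    irreflexive : ∀ {a} → New a → ¬ (a >[ W ] a)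
    irreflexive (new-s e∈) p = [ s≢t e∈ e∈ , s≢head e∈ e∈ ]′ (above-s e∈ p)
    irreflexive (new-t e∈) p = t≢head e∈ e∈ (above-t e∈ p)

    -- No `s e` is ever a target, and `t e` is a target only in the first batch, which precedes
    -- every wire with origin `t e`.
    W-ordered : Ordered W
    W-ordered = ordered-map-++ s t E s≢t s∉targets
      (subst Ordered (++-identityʳ wiresᵣ) (ordered-map-++ t head E t≢head (λ _ ()) []))
      where
      s∉targets : ∀ {e} → e ∈ E → s e ∉ map proj₂ wiresᵣ
      s∉targets e∈ s∈ with ∈-map⁻ proj₂ s∈
      ... | _ , w∈ , eq with _ , e′∈ , refl ← ∈-map⁻ (λ e → t e , head e) w∈ = s≢head e∈ e′∈ eq

    new-sprout : ∀ {u} → New u → SproutLabelled N u (ψ u)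
    new-sprout u-new = M⊆N (new⊆M u-new) , trans (L-N (new⊆M u-new)) (L-new u-new)

    W-wires : ∀ {w} → IsW w → IsWire N w
    W-wires (s⇝t e∈)    =
      (_ , new-sprout (new-s e∈)) , M⊆N (new⊆M (new-t e∈)) , s≢t e∈ e∈ ∘ sym
    W-wires (t⇝head e∈) =
      (_ , new-sprout (new-t e∈)) , M⊆N (V₀⊆M (head∈V₀ e∈)) , t≢head e∈ e∈ ∘ sym

    W-functional : ∀ {a r r′} → IsW (a , r) → IsW (a , r′) → r ≡ r′
    W-functional (s⇝t e∈)    w = sym (s-wire e∈ refl w)
    W-functional (t⇝head e∈) w = sym (t-wire e∈ refl w)

    -- Every edge of `N` ends in its own `s e`, so the sum is at most the number of edges `e` with
    -- `s e` above `r`. For `r` in `V₀` these edges have head `r`, and there are at most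
    -- `indegree r` of them; for a new `r` they satisfy `r ≡ t e`, which leaves at most one.
    W-injective : ∀ {r} → r ∈ V N →
      sum (map (λ u → pred u N) (filter (λ u → trans⁺? W u r) (V N))) ≤ R N r
    W-injective {r} r∈N = begin
      sum (map (λ u → pred u N) above)
        ≡⟨ cong sum (map-cong (pred-count N-heads) above) ⟩
      sum (map (λ u → count (λ e → s e ≟ u) E) above)
        ≤⟨ sum-count≤ _≟_ s E (Unique.filter⁺ _ V-N-unique) ⟩
      count inAbove? E
        ≤⟨ bound (∈-M⁻ r∈) ⟩
      R M r
        ≡⟨ R-≡ N≐ (M⊆parts r∈) ⟨
      R N r ∎
      where
      open ℕ.≤-Reasoning

      above : List 𝓥
      above = filter (λ u → trans⁺? W u r) (V N)

      inAbove? : Decidable (λ e → s e ∈ above)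
      inAbove? e = s e ∈? above

      r∈ : r ∈ V M
      r∈ = N⊆M r∈N

      V-N-unique : Unique (V N)
      V-N-unique = subst Unique (sym (V-≡ N≐)) parts-unique

      target : ∀ {e} → e ∈ E → s e ∈ above → r ≡ t e ⊎ r ≡ head e
      target e∈ se∈ = above-s e∈ (proj₂ (∈-filter⁻ (λ u → trans⁺? W u r) {xs = V N} se∈))

      bound : r ∈ V₀ ⊎ New r → count inAbove? E ≤ R M r
      bound (inj₁ r∈V₀)  = begin
        count inAbove? E
          ≤⟨ count-mono inAbove? (λ e → head e ≟ r) E (λ e∈ → toHead e∈ ∘ target e∈) ⟩
        indegree r          ≤⟨ ℕ.m≤n+m (indegree r) (R D₀ r) ⟩
        R D₀ r + indegree r ≡⟨ R-V₀ r∈V₀ ⟨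
        R M r               ∎
        where
        toHead : ∀ {e} → e ∈ E → r ≡ t e ⊎ r ≡ head e → head e ≡ r
        toHead e∈ (inj₁ refl) = contradiction r∈V₀ (t∉V₀ e∈)
        toHead e∈ (inj₂ eq)   = sym eq
      bound (inj₂ r-new) = begin
        count inAbove? E ≤⟨ count-unique inAbove? E-unique (λ e∈ e′∈ p q →
                              t-inj e∈ e′∈ (trans (sym (toT e∈ (target e∈ p))) (toT e′∈ (target e′∈ q)))) ⟩
        1                ≡⟨ R-new r-new ⟨
        R M r            ∎
        where
        toT : ∀ {e} → e ∈ E → r ≡ t e ⊎ r ≡ head e → r ≡ t e
        toT e∈ (inj₁ eq)   = eq
        toT e∈ (inj₂ refl) = contradiction (head∈V₀ e∈) (new∉V₀ r-new)

    W-wellBehaved : WellBehaved N W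
    W-wellBehaved = record
      { wires      = All.tabulate (W-wires ∘ ∈-W⁻)
      ; functional = λ w∈ w′∈ → W-functional (∈-W⁻ w∈) (∈-W⁻ w′∈)
      ; injective  = W-injective
      ; acyclic    = λ p → let q = flatten p in irreflexive (above-new q) q
      }
      where
      flatten : ∀ {a b} → TransClosure (λ t u → Sprout N t × Sprout N u × t >[ W ] u) a b →
                a >[ W ] b
      flatten [ _ , _ , p ]⁺    = p
      flatten ((_ , _ , p) ∷ q) = p ++⁺ flatten q

      above-new : ∀ {a b} → a >[ W ] b → New a
      above-new [ w∈ ]⁺  = origin-new (∈-W⁻ w∈)
      above-new (w∈ ∷ _) = origin-new (∈-W⁻ w∈)

    W-image : ∀ {a r} → IsW (a , r) → ∃ λ u → Image W r u
    W-image (s⇝t {e} e∈)    = head e , inj₂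
      (New⇒Origin (new-t e∈) , [ ∈-W⁺ (t⇝head e∈) ]⁺ , λ _ → ¬above-V₀ (head∈V₀ e∈))
    W-image (t⇝head {e} e∈) = head e , inj₁
      ((λ o → new∉V₀ (Origin⇒New o) (head∈V₀ e∈)) , refl)

    same-origin : ∀ {a a′ x} → New a → SproutLabelled N a x → SproutLabelled N a′ x → a ≡ a′
    same-origin a-new (_ , La) (a′∈ , La′) = new-label a-new (N⊆M a′∈)
      (trans (sym (L-N (new⊆M a-new))) La) (trans (sym (L-N (N⊆M a′∈))) La′)

    W-coherent : Coherent N W
    W-coherent = record
      { saturated  = λ a a′ o → subst (Origin W) (same-origin (Origin⇒New o) a a′) o
      ; compatible = compatible
      }
      where
      compatible : ∀ {a r a′ r′ x} → (a , r) ∈ W → (a′ , r′) ∈ W →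
        SproutLabelled N a x → SproutLabelled N a′ x →
        ∃₂ λ u u′ → Image W r u × Image W r′ u′ ×
          Equimorphic (subdrag (N ⟨ W ⟩) u) (subdrag (N ⟨ W ⟩) u′)
      compatible w∈ w′∈ a a′
        -- Origins with the same label are one sprout, hence both wires are the same by
        -- functionality, and the identity is the equimorphism.
        with refl ← same-origin (origin-new (∈-W⁻ w∈)) a a′
        with refl ← W-functional (∈-W⁻ w∈) (∈-W⁻ w′∈)
        with u , image ← W-image (∈-W⁻ w∈) = u , u , image , image , Equimorphic-refl

    switchboard : Switchboard A B
    switchboard = record
      { ξₗ          = wiresₗ
      ; ξᵣ          = wiresᵣ
      ; ξₗ-typed    = All.map⁺ (All.tabulate λ e∈ →
          (_ , A-sprout e∈) , ∈-resp-≡ (sym (V-≡ B≐)) (t∈ e∈) ,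
          ℕ.≤-reflexive (sym (trans (R-≡ B≐ (t∈ e∈)) (R-new (new-t e∈)))))
      ; ξᵣ-typed    = All.map⁺ (All.tabulate λ e∈ →
          (_ , B-sprout e∈) , ∈-resp-≡ (sym (V-≡ A≐)) (head∈ e∈) ,
          subst (0 <_) (sym (trans (R-≡ A≐ (head∈ e∈)) (R-V₀ (head∈V₀ e∈))))
            -- The edge `e` itself makes the in-degree of its head positive.
            (ℕ.≤-trans (filter-some (λ e → head e ≟ _) (lose e∈ refl)) (ℕ.m≤n+m _ _)))
      ; wellBehaved = W-wellBehaved
      ; coherent    = W-coherent
      }
      where
      s∈ : ∀ {e} → e ∈ E → s e ∈ left-all
      s∈ e∈ = ∈-left-all⁺ (left-s e∈)

      head∈ : ∀ {e} → e ∈ E → head e ∈ left-all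
      head∈ e∈ = ∈-left-all⁺ (old (head∈V₀ e∈))

      t∈ : ∀ {e} → e ∈ E → t e ∈ right-all
      t∈ e∈ = ∈-resp-≡ (sym right-all≡) (∈-map⁺ t e∈)

      A-sprout : ∀ {e} → e ∈ E → SproutLabelled A (s e) (ψ (s e))
      A-sprout e∈ = ∈-resp-≡ (sym (V-≡ A≐)) (s∈ e∈) ,
        trans (L-≡ A≐ (s∈ e∈)) (L-new (new-s e∈))

      B-sprout : ∀ {e} → e ∈ E → SproutLabelled B (t e) (ψ (t e))
      B-sprout e∈ = ∈-resp-≡ (sym (V-≡ B≐)) (t∈ e∈) ,
        trans (L-≡ B≐ (t∈ e∈)) (L-new (new-t e∈))

    -- Evaluation of the product

    product-expr : Expr
    product-expr = prodExpr (SumOf.expr leftSum) (SumOf.expr rightSum)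
      (Disjoint-resp-≐ A≐ B≐ (separate⇒disjoint all-separate)) switchboard

    value-product : value product-expr ≈ D₀
    value-product = subst (_≈ D₀) (sym product≡) record
      { V-≈ = mk⇔ final⊆V₀ (↭.∈-resp-↭ (↭-sym V-final))
      ; R-≈ = R-final ∘ final⊆V₀
      ; L-≈ = λ {v} v∈ → trans (cong (λ L → L v) L-final)
          (trans (L-N (V₀⊆M (final⊆V₀ v∈))) (L-V₀ (final⊆V₀ v∈)))
      ; X-≈ = λ v∈ → trans (HasHeads.X-V₀ final-heads (final⊆V₀ v∈)) (head-out _)
      }
      where
      N₁ final : RawDrag
      N₁    = foldl step N wiresₗ
      final = foldl step N₁ wiresᵣ

      product≡ : N ⟨ W ⟩ ≡ final
      product≡ = trans (⟨⟩-ordered N W-ordered) (foldl-++ step N wiresₗ wiresᵣ)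

      -- After this batch each edge ends in its own `t e`. The `t e` are then the remaining leaves,
      -- which is the starting position of the second batch.
      phase₁ = redirect E-unique s t s-inj s∉V₀ s≢t {leaves = map t E} new-unique N-heads

      N₁-heads : HasHeads N₁ t (map t E ++ [])
      N₁-heads = subst (HasHeads N₁ t) (sym (++-identityʳ (map t E))) (proj₁ phase₁)

      phase₂ = redirect E-unique t head t-inj t∉V₀ t≢head {leaves = []}
        (subst Unique (sym (++-identityʳ (map t E))) t-unique) N₁-heads

      final-heads : HasHeads final head []
      final-heads = proj₁ phase₂

      V-final : V final ↭ V₀
      V-final = ↭-trans (HasHeads.V-↭ final-heads) (↭-reflexive (++-identityʳ V₀))

      final⊆V₀ : ∀ {v} → v ∈ V final → v ∈ V₀
      final⊆V₀ = ↭.∈-resp-↭ V-final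

      L-final : L final ≡ L N
      L-final = trans (L-foldl-step wiresᵣ N₁) (L-foldl-step wiresₗ N)

      -- The targets of the first batch are new sprouts, so a vertex of `D` loses roots only in the
      -- second, namely one for each incoming edge: the `indegree v` roots added in `M`.
      R-final : ∀ {v} → v ∈ V₀ → R final v ≡ R D₀ v
      R-final {v} v∈ = begin
        R final v
          ≡⟨ proj₂ phase₂ v ⟩
        R N₁ v ∸ indegree v
          ≡⟨ cong (_∸ indegree v) (proj₂ phase₁ v) ⟩
        R N v ∸ count (λ e → t e ≟ v) E ∸ indegree v
          ≡⟨ cong (λ n → R N v ∸ n ∸ indegree v) t-none ⟩
        R N v ∸ indegree v
          ≡⟨ cong (_∸ indegree v) (R-≡ N≐ (M⊆parts (V₀⊆M v∈))) ⟩
        R M v ∸ indegree v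
          ≡⟨ cong (_∸ indegree v) (R-V₀ v∈) ⟩
        R D₀ v + indegree v ∸ indegree v
          ≡⟨ ℕ.m+n∸n≡m (R D₀ v) (indegree v) ⟩
        R D₀ v                                             ∎
        where
        open ≡-Reasoning
        t-none : count (λ e → t e ≟ v) E ≡ 0
        t-none = cong length (filter-none (λ e → t e ≟ v)
          (All.tabulate λ e∈ eq → t∉V₀ e∈ (subst (_∈ V₀) (sym eq) v∈)))

    components-parts : map raw (components product-expr) ≡ map part (left ++ right)
    components-parts = trans (map-++ raw (components (SumOf.expr leftSum)) _)
      (trans (cong₂ _++_ (SumOf.components-parts leftSum) (SumOf.components-parts rightSum))
        (sym (map-++ part left right)))

    components-atomic : All IsAtomic (components product-expr)
    components-atomic = All.map⁻ (subst (All _) (sym components-parts)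
      (All.map⁺ (All.++⁺ left-atomic right-atomic)))

    dragExpression : DragExpression
    dragExpression = record
      { expr     = product-expr
      ; disjoint = AllPairs.map⁻ (subst (AllPairs Disjoint) (sym components-parts)
          (AllPairs.map⁺ parts-disjoint))
      }

mainTheorem10 : (𝓢 : Setting) → let open Drags 𝓢 in
    (D : Drag) →
    ∃ λ (e : DragExpression) →
    All IsAtomic (components (expr e)) × value (expr e) ≈ raw D
mainTheorem10 𝓢 D = dragExpression , components-atomic , value-product
  where open Decomposition 𝓢 D
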